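{- Let $G=(V,E)$ be an $n$-vertex graph of maximum degree $\Delta\ge 3$ and treewidth $t\ge1$, and let $q$ be a positive integer. Suppose each vertex $v\in V$ has a color list $L_v$ with $\deg_G(v)+2\le|L_v|\le q$. Then the mixing time of the Glauber dynamics for sampling uniformly random list colorings of $G$ is $n^{O(t(\Delta+\log q))}$.
   Context: A list coloring assigns to each $v\in V$ a color $\sigma_v\in L_v$ such that adjacent vertices receive distinct colors; $\mu$ is the uniform distribution over list colorings. The Glauber dynamics picks a uniformly random vertex $v$ each step and recolors it with a uniformly random color of $L_v$ not used by its neighbors (i.e. from the conditional distribution of $\mu$ given the rest). Its mixing time is the smallest $t$ such that from every initial list coloring the distribution after $t$ steps is within total variation distance $1/4$ of $\mu$. The constant in $O(\cdot)$ is absolute. -}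

module Defs where

open import Data.Bool using (Bool; true; false; _∧_; _∨_; not; if_then_else_; T)
open import Data.Unit using (⊤)
open import Data.Nat as ℕ using (ℕ; zero; suc; _≤_; _+_; _*_; _^_)
open import Data.Nat.Logarithm using (⌈log₂_⌉)
open import Data.Fin using (Fin; zero; suc)
import Data.Fin as Fin
open import Data.Fin.Subset using (Subset; _∈_; ∣_∣)
open import Data.List as List using (List; []; _∷_; _++_; length; filterᵇ; allFin; concatMap; foldr)
open import Data.Bool.ListAction using (any; all)
open import Data.List.Relation.Unary.Unique.Propositional using (Unique)
open import Data.List.Membership.Propositional renaming (_∈_ to _∈ₗ_)
open import Data.Vec as Vec using (Vec; lookup)
open import Data.Vec.Properties using (≡-dec)
open import Data.Rational as ℚ using (ℚ; 0ℚ; 1ℚ; ½)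
open import Data.Integer using (+_)
open import Data.Product using (Σ; _×_; ∃; ∃-syntax; _,_)
open import Relation.Nullary using (¬_)
open import Relation.Nullary.Decidable using (⌊_⌋)
open import Relation.Binary.PropositionalEquality using (_≡_; _≢_)

record Graph (n : ℕ) : Set where
  field
    adj    : Fin n → Fin n → Bool
    sym    : ∀ u v → adj u v ≡ adj v u
    irrefl : ∀ v → adj v v ≡ false
open Graph public

Adjacent : ∀ {n} → Graph n → Fin n → Fin n → Set
Adjacent G u v = T (adj G u v)

deg : ∀ {n} → Graph n → Fin n → ℕ
deg G v = length (filterᵇ (adj G v) (allFin _))

MaxDegree : ∀ {n} → Graph n → ℕ → Set
MaxDegree G Δ = (∀ v → deg G v ℕ.≤ Δ) × (∃[ v ] deg G v ≡ Δ)

data WalkIn {m} (G : Graph m) (P : Fin m → Set) : Fin m → Fin m → Set where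
  here : ∀ {a} → P a → WalkIn G P a a
  step : ∀ {a b c} → P a → Adjacent G a b → WalkIn G P b c → WalkIn G P a c

Chain : ∀ {m} → Graph m → List (Fin m) → Set
Chain G []           = ⊤
Chain G (x ∷ [])     = ⊤
Chain G (x ∷ y ∷ xs) = Adjacent G x y × Chain G (y ∷ xs)

IsCycle : ∀ {m} → Graph m → Fin m → List (Fin m) → Set
IsCycle G x xs = (2 ℕ.≤ length xs) × Unique (x ∷ xs) × Chain G (x ∷ xs ++ x ∷ [])

Connected : ∀ {m} → Graph m → Set
Connected G = ∀ a b → WalkIn G (λ _ → ⊤) a b

Acyclic : ∀ {m} → Graph m → Set
Acyclic G = ∀ x xs → ¬ IsCycle G x xs

IsTree : ∀ {m} → Graph m → Set
IsTree G = Connected G × Acyclic G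

record TreeDecomposition {n} (G : Graph n) : Set where
  field
    m       : ℕ
    tree    : Graph (suc m)
    isTree  : IsTree tree
    bag     : Fin (suc m) → Subset n
    covers  : ∀ v → ∃[ i ] v ∈ bag i
    edgeIn  : ∀ u v → Adjacent G u v → ∃[ i ] (u ∈ bag i × v ∈ bag i)
    subtree : ∀ v i j → v ∈ bag i → v ∈ bag j →
              WalkIn tree (λ k → v ∈ bag k) i j
open TreeDecomposition public

WidthAtMost : ∀ {n} {G : Graph n} → TreeDecomposition G → ℕ → Set
WidthAtMost D w = ∀ i → ∣ bag D i ∣ ℕ.≤ suc w

Treewidth : ∀ {n} → Graph n → ℕ → Set
Treewidth G t = (Σ (TreeDecomposition G) λ D → WidthAtMost D t)
              × (∀ (D : TreeDecomposition G) → ∃[ i ] suc t ℕ.≤ ∣ bag D i ∣)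

Colouring : ℕ → Set
Colouring n = Vec ℕ n

IsListColouring : ∀ {n} → Graph n → (Fin n → List ℕ) → Colouring n → Set
IsListColouring G L σ =
  (∀ v → lookup σ v ∈ₗ L v) × (∀ u v → Adjacent G u v → lookup σ u ≢ lookup σ v)

-- all assignments σ with σ_v ∈ L v (each exactly once when lists are duplicate-free)
assignments : ∀ {n} → (Fin n → List ℕ) → List (Colouring n)
assignments {zero}  L = Vec.[] ∷ []
assignments {suc n} L =
  concatMap (λ c → List.map (c Vec.∷_) (assignments (λ v → L (suc v)))) (L zero)

properᵇ : ∀ {n} → Graph n → Colouring n → Bool
properᵇ G σ = all (λ u → all (λ v → not (adj G u v) ∨ not (lookup σ u ℕ.≡ᵇ lookup σ v))
                              (allFin _)) (allFin _)

Ω : ∀ {n} → Graph n → (Fin n → List ℕ) → List (Colouring n)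
Ω G L = filterᵇ (properᵇ G) (assignments L)

_==ᶜ_ : ∀ {n} → Colouring n → Colouring n → Bool
σ ==ᶜ τ = ⌊ ≡-dec ℕ._≟_ σ τ ⌋

-- 1 / k as a rational (0 if k = 0; only used with k ≥ 1)
inv : ℕ → ℚ
inv zero    = 0ℚ
inv (suc k) = + 1 ℚ./ suc k

Σℚ : ∀ {A : Set} → List A → (A → ℚ) → ℚ
Σℚ xs f = foldr (λ x acc → f x ℚ.+ acc) 0ℚ xs

μ : ∀ {n} → Graph n → (Fin n → List ℕ) → Colouring n → ℚ
μ G L τ = inv (length (Ω G L))

available : ∀ {n} → Graph n → (Fin n → List ℕ) → Colouring n → Fin n → List ℕ
available G L σ v =
  filterᵇ (λ c → not (any (λ u → adj G v u ∧ (lookup σ u ℕ.≡ᵇ c)) (allFin _))) (L v)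

agreeOff : ∀ {n} → Fin n → Colouring n → Colouring n → Bool
agreeOff v σ τ = all (λ u → ⌊ u Fin.≟ v ⌋ ∨ (lookup σ u ℕ.≡ᵇ lookup τ u)) (allFin _)

-- Glauber transition probability P(σ, τ): pick v uniformly, then a
-- uniformly random available colour at v.
P : ∀ {n} → Graph n → (Fin n → List ℕ) → Colouring n → Colouring n → ℚ
P {n} G L σ τ = Σℚ (allFin n) λ v →
  if agreeOff v σ τ ∧ any (λ c → c ℕ.≡ᵇ lookup τ v) (available G L σ v)
  then inv n ℚ.* inv (length (available G L σ v))
  else 0ℚ

dist : ∀ {n} → Graph n → (Fin n → List ℕ) → Colouring n → ℕ → Colouring n → ℚ
dist G L σ₀ zero    τ = if σ₀ ==ᶜ τ then 1ℚ else 0ℚ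
dist G L σ₀ (suc s) τ = Σℚ (Ω G L) λ ρ → dist G L σ₀ s ρ ℚ.* P G L ρ τ

dTV : ∀ {n} → Graph n → (Fin n → List ℕ) → Colouring n → ℕ → ℚ
dTV G L σ₀ s = ½ ℚ.* Σℚ (Ω G L) λ τ → ℚ.∣ dist G L σ₀ s τ ℚ.- μ G L τ ∣

-- the mixing time is at most T:  some s ≤ T has d_TV ≤ 1/4 from every start
-- (equivalently, the smallest such s is ≤ T)
MixingTimeAtMost : ∀ {n} → Graph n → (Fin n → List ℕ) → ℕ → Set
MixingTimeAtMost G L T =
  ∃[ s ] (s ℕ.≤ T × (∀ σ₀ → IsListColouring G L σ₀ → dTV G L σ₀ s ℚ.≤ (+ 1 ℚ./ 4)))

{-# OPTIONS --safe #-}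
module Submission where

-- Write k_S for the kernel that resamples a uniform colouring among those
-- agreeing with the current one off S, and E_S f = Σ k_S(σ,τ) (f σ - f τ)² for
-- its Dirichlet form; the Glauber dynamics is the average of the k_{v}.
-- The energy E_V is compared with D = Σ_v E_{v} by dismantling S = V:
--  * if S is the disjoint union of A and B with no edges between them, then
--    k_S ≤ k_A k_B pointwise, hence E_S ≤ 2 E_A + 2 E_B;
--  * if x ∈ S and S' = S - x, then k_S ≤ q 2^Δ k_S' k_{x} k_S' pointwise, hence
--    E_S ≤ q 2^Δ (6 E_S' + 4 E_{x}).  Indeed, a vertex has at least two available
--    colours given its neighbours, so at least a 2^-Δ fraction of the colourings
--    leave a prescribed colour of x unused on the neighbours of x.
-- A tree decomposition of width t provides balanced separators of size t + 1, so
-- O(t log n) vertex removals and O(log n) splits along each branch exhaust V, and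
-- E_V ≤ n^{O(t(Δ + log q))} D.  Since the Glauber kernel is symmetric and an average
-- of projections, this spectral gap makes the L² distance to uniform decay.

open import Defs
open import Data.Bool using (Bool; true; false; _∧_; _∨_; not; T; if_then_else_)
open import Data.Bool.ListAction using (any; all)
open import Data.Bool.Properties using (T-∧; T-∨; T?)
open import Data.Empty using (⊥; ⊥-elim)
open import Data.Fin using (Fin; zero; suc)
open import Data.Fin.Properties using (all?) renaming (_≟_ to _≟ᶠ_)
open import Data.Fin.Subset as Sub using (Subset; inside; outside; _∈_; _∉_; _⊆_; _∩_; _∪_; _─_; ⁅_⁆; ∣_∣)
open import Data.Fin.Subset.Properties using (_∈?_; x∈⁅x⁆; x∈⁅y⁆⇒x≡y; x∈p∧x≢y⇒x∈p-y; x∈p∧x∉q⇒x∈p─q; p─q⊆p; p⊆q⇒∣p∣≤∣q∣; p⊂q⇒∣p∣<∣q∣; x∈p∩q⁺; x∈p∩q⁻; x∈p∪q⁺; x∈p∪q⁻; nonempty?; ∣p∩q∣≤∣q∣; x∈p⇒∣p-x∣<∣p∣; ∈⊤; ∣⊤∣≡n; ∣⊥∣≡0; Empty-unique)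
import Data.Integer as ℤ
import Data.Integer.Properties as ℤₚ
open import Data.List using (List; []; _∷_; _++_; length; filter; filterᵇ; map; allFin; concatMap; cartesianProduct; cartesianProductWith)
open import Data.List.Membership.DecPropositional using () renaming (_∈?_ to mem?)
open import Data.List.Membership.Propositional using (lose; find) renaming (_∈_ to _∈ₗ_)
open import Data.List.Membership.Propositional.Properties using (∈-filter⁺; ∈-filter⁻; ∈-map⁺; ∈-++⁺ˡ; ∈-++⁺ʳ; ∈-++⁻; ∈-∃++; ∈-allFin; ∈-cartesianProduct⁻; ∈-cartesianProductWith⁺; ∈-cartesianProductWith⁻)
open import Data.List.Properties using (length-map; length-++; length-filter; length-tabulate; filter-≐; filter-all)
import Data.List.Relation.Unary.All as All
open import Data.List.Relation.Unary.All.Properties using (¬Any⇒All¬; all⁺; all⁻)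
open import Data.List.Relation.Unary.AllPairs using ([]; _∷_)
open import Data.List.Relation.Unary.Any using (here; there)
open import Data.List.Relation.Unary.Any.Properties using (any⁺; any⁻)
open import Data.List.Relation.Unary.Unique.Propositional using (Unique)
import Data.List.Relation.Unary.Unique.Propositional.Properties as Uniq
open import Data.Nat as ℕ using (ℕ; zero; suc; z≤n; s≤s)
open import Data.Nat.Induction using (<-rec)
open import Data.Nat.Logarithm using (⌈log₂_⌉; ⌈log₂⌉-mono-≤; ⌈log₂⌈n/2⌉⌉≡⌈log₂n⌉∸1)
import Data.Nat.Properties as ℕₚ
open import Data.Nat.Tactic.RingSolver using (solve-∀)
open import Data.Product using (Σ; _×_; ∃-syntax; _,_; proj₁; proj₂)
open import Data.Rational as ℚ using (ℚ; 0ℚ; 1ℚ; ½; nonNegative)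
import Data.Rational.Properties as ℚₚ
open import Data.Rational.Solver using () renaming (module +-*-Solver to ℚ-Solver)
import Data.Rational.Unnormalised as ℚᵘ
import Data.Rational.Unnormalised.Properties as ℚᵘₚ
open import Data.Sum using (_⊎_; inj₁; inj₂; [_,_]′)
open import Data.Unit using (⊤; tt)
open import Data.Vec using (Vec; []; _∷_; here; there; lookup; tabulate; _[_]≔_)
open import Data.Vec.Properties using (≡-dec; lookup∘update; lookup∘update′; lookup∘tabulate; tabulate∘lookup; tabulate-cong; ∷-injective)
open import Function using (_∘_; id)
open import Function.Bundles using (Equivalence)
open import Relation.Binary.PropositionalEquality using (_≡_; _≢_; refl; cong; cong₂; subst; subst₂; trans; module ≡-Reasoning) renaming (sym to ≡-sym)
open import Relation.Binary.Structures using (IsEquivalence)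
open import Relation.Nullary using (¬_; Dec; yes; no; does)
open import Relation.Nullary.Decidable using (⌊_⌋; ¬?; _⊎-dec_; _→-dec_; map′; dec-true; dec-false; toWitness; isYes≗does)
open import Relation.Unary using (Decidable)
open Equivalence using (to; from)

-- Balanced separators from tree decompositions

-- Every comparison multiplies the constant, so only the number of steps along one branch matters. A
-- split is cheap because both parts share a constant and are measured against the same D: one level
-- of splitting costs a factor 4, whatever the number of branches. A vertex removal costs 10 q 2^Δ,
-- which is affordable t + 1 times per level, and 2k levels suffice when 2^k > n because (3/2)^2 >
-- 2. The obstacle in a removal is that the colour τ_x wanted at x may be blocked around x in σ. A
-- single route would have far too little weight; it is the sum over all such ρ that reduces the
-- loss to q 2^Δ, independent of n. Products of symmetric kernels are not symmetric in general, so
-- the comparisons run in the class of doubly stochastic kernels. All quantities are rational: the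
-- spectral gap appears as an inequality between energies, the decay as a statement on squared
-- norms, and total variation is bounded through its square.

module Separators where

  open import Data.Nat using (_≤_; _*_; _+_)
  open ℕₚ using (≤-trans; ≤-refl; ≤-total; +-suc; *-distribˡ-+; *-monoʳ-≤; +-mono-≤; +-cancelʳ-≤; m≤m+n; +-comm; +-identityʳ; module ≤-Reasoning)

  x∈p─q⇒x∉q : ∀ {n} {x : Fin n} (p q : Subset n) → x ∈ p ─ q → x ∉ q
  x∈p─q⇒x∉q (_ ∷ p) (_ ∷ q) (there h) (there k) = x∈p─q⇒x∉q p q h k

  ∣p∩q∣+∣p─q∣≡∣p∣ : ∀ {n} (p q : Subset n) → ∣ p ∩ q ∣ + ∣ p ─ q ∣ ≡ ∣ p ∣
  ∣p∩q∣+∣p─q∣≡∣p∣ []            []            = refl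
  ∣p∩q∣+∣p─q∣≡∣p∣ (outside ∷ p) (outside ∷ q) = ∣p∩q∣+∣p─q∣≡∣p∣ p q
  ∣p∩q∣+∣p─q∣≡∣p∣ (outside ∷ p) (inside  ∷ q) = ∣p∩q∣+∣p─q∣≡∣p∣ p q
  ∣p∩q∣+∣p─q∣≡∣p∣ (inside  ∷ p) (inside  ∷ q) = cong suc (∣p∩q∣+∣p─q∣≡∣p∣ p q)
  ∣p∩q∣+∣p─q∣≡∣p∣ (inside  ∷ p) (outside ∷ q) =
    trans (+-suc ∣ p ∩ q ∣ ∣ p ─ q ∣) (cong suc (∣p∩q∣+∣p─q∣≡∣p∣ p q))

  p⊆q∪r⇒∣p∣≤∣q∣+∣r∣ : ∀ {n} {p q r : Subset n} → p ⊆ q ∪ r → ∣ p ∣ ≤ ∣ q ∣ + ∣ r ∣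
  p⊆q∪r⇒∣p∣≤∣q∣+∣r∣ {p = p} {q} {r} h = begin
    ∣ p ∣                       ≡⟨ ≡-sym (∣p∩q∣+∣p─q∣≡∣p∣ p q) ⟩
    ∣ p ∩ q ∣ + ∣ p ─ q ∣       ≤⟨ +-mono-≤ (p⊆q⇒∣p∣≤∣q∣ (λ k → proj₂ (x∈p∩q⁻ p q k)))
                                            (p⊆q⇒∣p∣≤∣q∣ sub) ⟩
    ∣ q ∣ + ∣ r ∣               ∎
    where
    open ≤-Reasoning
    sub : p ─ q ⊆ r
    sub k with x∈p∪q⁻ q r (h (p─q⊆p p q k))
    ... | inj₁ x∈q = ⊥-elim (x∈p─q⇒x∉q p q k x∈q)
    ... | inj₂ x∈r = x∈r

  empty⇒∣p∣≡0 : ∀ {n} {p : Subset n} → (∀ x → x ∉ p) → ∣ p ∣ ≡ 0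
  empty⇒∣p∣≡0 {n} {p} h = trans (cong ∣_∣ (Empty-unique {p = p} (λ (x , k) → h x k))) (∣⊥∣≡0 n)

  -- Walks, loop erasure and cycles

  module _ {k} (H : Graph k) where

    -- A simple path that starts at `j` cannot take the reverse step from `p` to `j`, so forbidding
    -- this one direction excludes the edge altogether.
    WalkAvoiding : Fin k → Fin k → Fin k → List (Fin k) → Fin k → Set
    WalkAvoiding j p a []       c = a ≡ c
    WalkAvoiding j p a (x ∷ xs) c = (Adjacent H a x × ¬ (a ≡ j × x ≡ p)) × WalkAvoiding j p x xs c

    avoiding-++ : ∀ {j p a b c} xs ys → WalkAvoiding j p a xs b → WalkAvoiding j p b ys c →
                  WalkAvoiding j p a (xs ++ ys) c
    avoiding-++ []       ys refl    w = w
    avoiding-++ (x ∷ xs) ys (e , v) w = e , avoiding-++ xs ys v w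

    private
      suffix : ∀ {j p a b c} xs → a ∈ₗ (b ∷ xs) → Unique (b ∷ xs) → WalkAvoiding j p b xs c →
               ∃[ ys ] (Unique (a ∷ ys) × WalkAvoiding j p a ys c)
      suffix xs       (here refl) u       w       = xs , u , w
      suffix (x ∷ xs) (there h)   (_ ∷ u) (_ , w) = suffix xs h u w

    loop-erase : ∀ {j p a c} xs → WalkAvoiding j p a xs c →
                 ∃[ ys ] (Unique (a ∷ ys) × WalkAvoiding j p a ys c)
    loop-erase [] refl = [] , All.[] ∷ [] , refl
    loop-erase {a = a} (x ∷ xs) (e , w) with loop-erase xs w
    ... | ys , u , w′ with mem? _≟ᶠ_ a (x ∷ ys)
    ...   | yes h = suffix ys h u w′
    ...   | no ¬h = x ∷ ys , ¬Any⇒All¬ (x ∷ ys) ¬h ∷ u , e , w′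

    private
      closing : ∀ {j p a c z} xs → WalkAvoiding j p a xs c → Adjacent H c z →
                Chain H (a ∷ xs ++ z ∷ [])
      closing []       refl          e = e , tt
      closing (x ∷ xs) ((f , _) , w) e = f , closing xs w e

    -- After loop erasure, an empty path would make `p j` a loop, a single step is the forbidden
    -- one, and anything longer closes up to a cycle through the edge `p j`.
    acyclic⇒no-bypass : Acyclic H → ∀ {j p} → Adjacent H p j →
                        ∀ xs → ¬ WalkAvoiding j p j xs p
    acyclic⇒no-bypass ac {j} {p} e xs w with loop-erase xs w
    ... | []         , u , refl              = subst T (irrefl H j) e
    ... | x ∷ []     , u , (_ , ne) , x≡p    = ne (refl , x≡p)
    ... | x ∷ y ∷ ys , u , w′                =
      ac j (x ∷ y ∷ ys) (s≤s (s≤s z≤n) , u , closing (x ∷ y ∷ ys) w′ e)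

    adjacent-sym : ∀ {a b} → Adjacent H a b → Adjacent H b a
    adjacent-sym {a} {b} = subst T (sym H a b)

    walk-start : ∀ {Q a b} → WalkIn H Q a b → Q a
    walk-start (here q)     = q
    walk-start (step q _ _) = q

    walk-map : ∀ {Q R a b} → (∀ {i} → Q i → R i) → WalkIn H Q a b → WalkIn H R a b
    walk-map f (here q)     = here (f q)
    walk-map f (step q e w) = step (f q) e (walk-map f w)

    walk-snoc : ∀ {Q a b c} → WalkIn H Q a b → Adjacent H b c → Q c → WalkIn H Q a c
    walk-snoc (here q)     e r = step q e (here r)
    walk-snoc (step q f w) e r = step q f (walk-snoc w e r)

    walk⇒avoiding : ∀ {Q j p a b} → (Q j → Q p → ⊥) → WalkIn H Q a b →
                    ∃[ xs ] WalkAvoiding j p a xs b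
    walk⇒avoiding ne (here q)     = [] , refl
    walk⇒avoiding ne (step q e w) with walk⇒avoiding ne w
    ... | xs , w′ = _ ∷ xs , (e , λ { (refl , refl) → ne q (walk-start w) }) , w′

  -- T ▷ U is T with the root of U made a child of the root of T.
  data RTree (k : ℕ) : Set where
    leaf : Fin k → RTree k
    _▷_  : RTree k → RTree k → RTree k

  module _ {k : ℕ} where

    root : RTree k → Fin k
    root (leaf i) = i
    root (T ▷ U)  = root T

    _∈ᵗ_ : Fin k → RTree k → Set
    i ∈ᵗ leaf j  = i ≡ j
    i ∈ᵗ (T ▷ U) = i ∈ᵗ T ⊎ i ∈ᵗ U

    _∈ᵗ?_ : ∀ i T → Dec (i ∈ᵗ T)
    i ∈ᵗ? leaf j  = i ≟ᶠ j
    i ∈ᵗ? (T ▷ U) = (i ∈ᵗ? T) ⊎-dec (i ∈ᵗ? U)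

    root∈ : ∀ T → root T ∈ᵗ T
    root∈ (leaf i) = refl
    root∈ (T ▷ U)  = inj₁ (root∈ T)

    -- The membership proof singles out the occurrence of `p` that receives `j` as a child. Roots of
    -- all subtrees are preserved, so every other parent relation survives.
    attach : ∀ {p} T → p ∈ᵗ T → Fin k → RTree k
    attach (leaf i) _        j = leaf i ▷ leaf j
    attach (T ▷ U)  (inj₁ h) j = attach T h j ▷ U
    attach (T ▷ U)  (inj₂ h) j = T ▷ attach U h j

    root-attach : ∀ {p} T (h : p ∈ᵗ T) j → root (attach T h j) ≡ root T
    root-attach (leaf i) _        j = refl
    root-attach (T ▷ U)  (inj₁ h) j = root-attach T h j
    root-attach (T ▷ U)  (inj₂ h) j = refl

    ∈-attach⁺ : ∀ {p} T (h : p ∈ᵗ T) j {i} → i ∈ᵗ T → i ∈ᵗ attach T h j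
    ∈-attach⁺ (leaf i) _        j m        = inj₁ m
    ∈-attach⁺ (T ▷ U)  (inj₁ h) j (inj₁ m) = inj₁ (∈-attach⁺ T h j m)
    ∈-attach⁺ (T ▷ U)  (inj₁ h) j (inj₂ m) = inj₂ m
    ∈-attach⁺ (T ▷ U)  (inj₂ h) j (inj₁ m) = inj₁ m
    ∈-attach⁺ (T ▷ U)  (inj₂ h) j (inj₂ m) = inj₂ (∈-attach⁺ U h j m)

    new∈attach : ∀ {p} T (h : p ∈ᵗ T) j → j ∈ᵗ attach T h j
    new∈attach (leaf i) _        j = inj₂ refl
    new∈attach (T ▷ U)  (inj₁ h) j = inj₁ (new∈attach T h j)
    new∈attach (T ▷ U)  (inj₂ h) j = inj₂ (new∈attach U h j)

    ∈-attach⁻ : ∀ {p} T (h : p ∈ᵗ T) j {i} → i ∈ᵗ attach T h j → i ∈ᵗ T ⊎ i ≡ j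
    ∈-attach⁻ (leaf i) _        j m        = m
    ∈-attach⁻ (T ▷ U)  (inj₁ h) j (inj₁ m) = [ inj₁ ∘ inj₁ , inj₂ ]′ (∈-attach⁻ T h j m)
    ∈-attach⁻ (T ▷ U)  (inj₁ h) j (inj₂ m) = inj₁ (inj₂ m)
    ∈-attach⁻ (T ▷ U)  (inj₂ h) j (inj₁ m) = inj₁ (inj₁ m)
    ∈-attach⁻ (T ▷ U)  (inj₂ h) j (inj₂ m) = [ inj₁ ∘ inj₂ , inj₂ ]′ (∈-attach⁻ U h j m)

  -- Rooting a tree decomposition

  module RootedDecomposition {n} {G : Graph n} (D : TreeDecomposition G) where

    private
      K : ℕ
      K = suc (m D)
      H : Graph K
      H = tree D

    verts : RTree K → Subset n
    verts (leaf i) = bag D i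
    verts (T ▷ U)  = verts T ∪ verts U

    ∈verts⁺ : ∀ {v i} T → i ∈ᵗ T → v ∈ bag D i → v ∈ verts T
    ∈verts⁺ (leaf i) refl     h = h
    ∈verts⁺ (T ▷ U)  (inj₁ m) h = x∈p∪q⁺ (inj₁ (∈verts⁺ T m h))
    ∈verts⁺ (T ▷ U)  (inj₂ m) h = x∈p∪q⁺ (inj₂ (∈verts⁺ U m h))

    ∈verts⁻ : ∀ {v} T → v ∈ verts T → ∃[ i ] (i ∈ᵗ T × v ∈ bag D i)
    ∈verts⁻ (leaf i) h = i , refl , h
    ∈verts⁻ (T ▷ U)  h with x∈p∪q⁻ (verts T) (verts U) h
    ... | inj₁ h′ = let (i , m , b) = ∈verts⁻ T h′ in i , inj₁ m , b
    ... | inj₂ h′ = let (i , m , b) = ∈verts⁻ U h′ in i , inj₂ m , b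

    -- The running intersection property, tree edge by tree edge: the two sides of an edge share
    -- only vertices lying in the bags at both of its ends. The search for a separator uses the
    -- `subtree` axiom in this form.
    Good : RTree K → Set
    Good (leaf i) = ⊤
    Good (T ▷ U)  = Good T × Good U ×
      (∀ {v} → v ∈ verts T → v ∈ verts U → v ∈ bag D (root T) × v ∈ bag D (root U))

    -- Connectedness of the part built so far; `separates` needs a walk back to `p` that stays
    -- inside it and hence misses the new node.
    Joined : RTree K → Set
    Joined T = ∀ {a b} → a ∈ᵗ T → b ∈ᵗ T → WalkIn H (_∈ᵗ T) a b

    private
      verts-attach⁻ : ∀ {p v} T (h : p ∈ᵗ T) j → v ∈ verts (attach T h j) → v ∈ verts T ⊎ v ∈ bag D j
      verts-attach⁻ T h j m with ∈verts⁻ (attach T h j) m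
      ... | i , i∈ , b with ∈-attach⁻ T h j i∈
      ...   | inj₁ i∈T  = inj₁ (∈verts⁺ T i∈T b)
      ...   | inj₂ refl = inj₂ b

      -- If the new bag brings to one side a vertex present on the other, then by `sep` this vertex
      -- lies in `bag D p`. It was thus on both sides already, and the old property applies.
      good-attach : ∀ {p} T (h : p ∈ᵗ T) j → (∀ {v} → v ∈ verts T → v ∈ bag D j → v ∈ bag D p) →
                    Good T → Good (attach T h j)
      good-attach (leaf i) refl     j sep _ = tt , tt , λ a b → a , b
      good-attach (T ▷ U)  (inj₁ h) j sep (gT , gU , x) =
        good-attach T h j (λ a → sep (x∈p∪q⁺ (inj₁ a))) gT , gU , cross
        where
        cross : ∀ {v} → v ∈ verts (attach T h j) → v ∈ verts U →
                v ∈ bag D (root (attach T h j)) × v ∈ bag D (root U)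
        cross a b rewrite root-attach T h j with verts-attach⁻ T h j a
        ... | inj₁ a′ = x a′ b
        ... | inj₂ a′ = x (∈verts⁺ T h (sep (x∈p∪q⁺ (inj₂ b)) a′)) b
      good-attach (T ▷ U)  (inj₂ h) j sep (gT , gU , x) =
        gT , good-attach U h j (λ a → sep (x∈p∪q⁺ (inj₂ a))) gU , cross
        where
        cross : ∀ {v} → v ∈ verts T → v ∈ verts (attach U h j) →
                v ∈ bag D (root T) × v ∈ bag D (root (attach U h j))
        cross a b rewrite root-attach U h j with verts-attach⁻ U h j b
        ... | inj₁ b′ = x a b′
        ... | inj₂ b′ = x a (∈verts⁺ U h (sep (x∈p∪q⁺ (inj₁ a)) b′))

      joined-attach : ∀ {p} T (h : p ∈ᵗ T) j → Adjacent H p j → Joined T → Joined (attach T h j)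
      joined-attach {p} T h j e joined {a} {b} a∈ b∈ with ∈-attach⁻ T h j a∈ | ∈-attach⁻ T h j b∈
      ... | inj₁ a∈T  | inj₁ b∈T  = walk-map H (∈-attach⁺ T h j) (joined a∈T b∈T)
      ... | inj₁ a∈T  | inj₂ refl = walk-snoc H (walk-map H (∈-attach⁺ T h j) (joined a∈T h)) e b∈
      ... | inj₂ refl | inj₁ b∈T  = step a∈ (adjacent-sym H e) (walk-map H (∈-attach⁺ T h j) (joined h b∈T))
      ... | inj₂ refl | inj₂ refl = here a∈

      -- Otherwise j would reach p through nodes whose bags contain v and then
      -- inside T, closing a cycle with the edge p j.
      separates : ∀ {p j} T → p ∈ᵗ T → ¬ (j ∈ᵗ T) → Adjacent H p j → Joined T →
                  ∀ {v} → v ∈ verts T → v ∈ bag D j → v ∈ bag D p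
      separates {p} {j} T p∈ j∉ e joined {v} v∈T v∈j with v ∈? bag D p
      ... | yes v∈p = v∈p
      ... | no  v∉p with ∈verts⁻ T v∈T
      ...   | i , i∈ , v∈i with walk⇒avoiding H {j = j} {p} (λ _ → v∉p) (subtree D v j i v∈j v∈i)
                              | walk⇒avoiding H {j = j} {p} (λ j∈ _ → j∉ j∈) (joined i∈ p∈)
      ...     | xs , w | ys , w′ =
        ⊥-elim (acyclic⇒no-bypass H (proj₂ (isTree D)) e (xs ++ ys) (avoiding-++ H xs ys w w′))

    record Partial : Set where
      field
        tr     : RTree K
        good   : Good tr
        joined : Joined tr
    open Partial

    private
      -- Nodes are attached as the walk discovers them, each below its predecessor on the walk,
      -- which is already present.
      extend : ∀ (R : Partial) {a c} → a ∈ᵗ tr R → WalkIn H (λ _ → ⊤) a c →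
               Σ Partial λ R′ → (∀ {i} → i ∈ᵗ tr R → i ∈ᵗ tr R′) × c ∈ᵗ tr R′
      extend R a∈ (here _) = R , id , a∈
      extend R {a} a∈ (step {b = b} _ e w) with b ∈ᵗ? tr R
      ... | yes b∈ = extend R b∈ w
      ... | no  b∉ with extend R₁ (new∈attach (tr R) a∈ b) w
        where
        R₁ : Partial
        R₁ = record
          { tr     = attach (tr R) a∈ b
          ; good   = good-attach (tr R) a∈ b (separates (tr R) a∈ b∉ e (joined R)) (good R)
          ; joined = joined-attach (tr R) a∈ b e (joined R)
          }
      ...   | R′ , ⊆R′ , c∈ = R′ , ⊆R′ ∘ ∈-attach⁺ (tr R) a∈ b , c∈

      gather : ∀ (is : List (Fin K)) → Σ Partial λ R → ∀ {i} → i ∈ₗ is → i ∈ᵗ tr R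
      gather [] = record { tr = leaf zero ; good = tt ; joined = λ { refl refl → here refl } } , λ ()
      gather (i ∷ is) with gather is
      ... | R , all∈ with extend R (root∈ (tr R)) (proj₁ (isTree D) (root (tr R)) i)
      ...   | R′ , ⊆R′ , i∈ = R′ , λ { (here refl) → i∈ ; (there h) → ⊆R′ (all∈ h) }

    rooted : Σ (RTree K) λ T → Good T × (∀ i → i ∈ᵗ T)
    rooted with gather (allFin K)
    ... | R , all∈ = tr R , good R , λ i → all∈ (∈-allFin i)

  -- The balance is relative to `S`, but `closed` concerns the whole graph. The same `X` and `A`
  -- therefore still separate every subset of `S`, which allows the vertices of `X` to be removed
  -- one at a time.
  record Separator {n} (G : Graph n) (w : ℕ) (S : Subset n) : Set where
    field
      X A    : Subset n
      size   : ∣ X ∣ ≤ suc w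
      closed : ∀ {v u} → v ∈ A → Adjacent G v u → u ∈ A ∪ X
      inner  : 3 * ∣ S ∩ A ∣ ≤ 2 * ∣ S ∣
      outer  : 3 * ∣ S ─ (A ∪ X) ∣ ≤ 2 * ∣ S ∣

  -- The search for a balanced cut

  module Balance {n} {G : Graph n} (D : TreeDecomposition G) {w} (width : WidthAtMost D w)
                 (S : Subset n) where

    open RootedDecomposition D

    -- The vertices strictly below the root: the side that the root bag cuts off.
    hang : RTree (suc (m D)) → Subset n
    hang T = verts T ─ bag D (root T)

    private
      -- Edges at `hang T` are witnessed by bags of `T`, so their other ends lie in `hang T` or in
      -- the root bag.
      Closed : RTree (suc (m D)) → Set
      Closed T = ∀ {v u} → v ∈ hang T → Adjacent G v u → ∃[ i ] (i ∈ᵗ T × v ∈ bag D i × u ∈ bag D i)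

      verts⊆ : ∀ T → verts T ⊆ hang T ∪ bag D (root T)
      verts⊆ T {v} v∈ with v ∈? bag D (root T)
      ... | yes b = x∈p∪q⁺ (inj₂ b)
      ... | no ¬b = x∈p∪q⁺ (inj₁ (x∈p∧x∉q⇒x∈p─q v∈ ¬b))

      half : ∀ {Z} → ∣ S ∣ ≤ 3 * ∣ S ∩ Z ∣ → 3 * ∣ S ─ Z ∣ ≤ 2 * ∣ S ∣
      half {Z} h = +-cancelʳ-≤ ∣ S ∣ _ _ (begin
        3 * ∣ S ─ Z ∣ + ∣ S ∣             ≤⟨ +-mono-≤ (≤-refl {3 * ∣ S ─ Z ∣}) h ⟩
        3 * ∣ S ─ Z ∣ + 3 * ∣ S ∩ Z ∣     ≡⟨ ≡-sym (*-distribˡ-+ 3 ∣ S ─ Z ∣ ∣ S ∩ Z ∣) ⟩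
        3 * (∣ S ─ Z ∣ + ∣ S ∩ Z ∣)       ≡⟨ cong (3 *_) (+-comm ∣ S ─ Z ∣ ∣ S ∩ Z ∣) ⟩
        3 * (∣ S ∩ Z ∣ + ∣ S ─ Z ∣)       ≡⟨ cong (3 *_) (∣p∩q∣+∣p─q∣≡∣p∣ S Z) ⟩
        3 * ∣ S ∣                         ≡⟨ +-comm ∣ S ∣ (2 * ∣ S ∣) ⟩
        2 * ∣ S ∣ + ∣ S ∣                 ∎)
        where open ≤-Reasoning

      ∩-monoʳ : ∀ {Y Z : Subset n} → Y ⊆ Z → S ∩ Y ⊆ S ∩ Z
      ∩-monoʳ {Y} h k with x∈p∩q⁻ S Y k
      ... | a , b = x∈p∩q⁺ (a , h b)

      separator : ∀ T → Closed T → 3 * ∣ S ∩ hang T ∣ ≤ 2 * ∣ S ∣ →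
                  3 * ∣ S ─ (hang T ∪ bag D (root T)) ∣ ≤ 2 * ∣ S ∣ → Separator G w S
      separator T cl i o = record
        { X = bag D (root T) ; A = hang T ; size = width (root T)
        ; closed = λ v∈ e → let (j , j∈ , _ , u∈) = cl v∈ e in verts⊆ T (∈verts⁺ T j∈ u∈)
        ; inner = i ; outer = o }

      heavy : ∀ T → ∣ S ∣ ≤ 3 * ∣ S ∩ verts T ∣ →
              3 * ∣ S ─ (hang T ∪ bag D (root T)) ∣ ≤ 2 * ∣ S ∣
      heavy T h = half (≤-trans h (*-monoʳ-≤ 3 (p⊆q⇒∣p∣≤∣q∣ (∩-monoʳ (verts⊆ T)))))

      -- Cut at the first root below which at least a third of S has accumulated: one
      -- step adds less than a third, so at most two thirds of S lies below it.
      search : ∀ T → Good T → Closed T → Separator G w S ⊎ 3 * ∣ S ∩ hang T ∣ ≤ ∣ S ∣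
      search (leaf i) _ _ = inj₂ (subst (λ z → 3 * z ≤ ∣ S ∣) (≡-sym (empty⇒∣p∣≡0 none)) z≤n)
        where
        none : ∀ x → x ∉ S ∩ hang (leaf i)
        none x h = let k = proj₂ (x∈p∩q⁻ S _ h) in
          x∈p─q⇒x∉q (bag D i) (bag D i) k (p─q⊆p (bag D i) (bag D i) k)
      search (T ▷ U) (gT , gU , x) cl = go (search T gT clT) (search U gU clU)
        where
        -- A bag of `U` containing `v` would put `v` on both sides, hence into the root bag of `T`,
        -- which `hang T` excludes.
        clT : Closed T
        clT {v} h e with cl (x∈p∧x∉q⇒x∈p─q (x∈p∪q⁺ (inj₁ (p─q⊆p _ _ h))) (x∈p─q⇒x∉q (verts T) _ h)) e
        ... | i , inj₁ m , r      = i , m , r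
        ... | i , inj₂ m , b , _  =
          ⊥-elim (x∈p─q⇒x∉q (verts T) _ h (proj₁ (x (p─q⊆p _ _ h) (∈verts⁺ U m b))))
        clU : Closed U
        clU {v} h e with v ∈? verts T
        ... | yes v∈T = ⊥-elim (x∈p─q⇒x∉q (verts U) _ h (proj₂ (x v∈T (p─q⊆p _ _ h))))
        ... | no  v∉T with cl (x∈p∧x∉q⇒x∈p─q (x∈p∪q⁺ (inj₂ (p─q⊆p _ _ h)))
                                              (v∉T ∘ ∈verts⁺ T (root∈ T))) e
        ...   | i , inj₁ m , b , _ = ⊥-elim (v∉T (∈verts⁺ T m b))
        ...   | i , inj₂ m , r     = i , m , r

        hang⊆ : S ∩ hang (T ▷ U) ⊆ (S ∩ hang T) ∪ (S ∩ verts U)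
        hang⊆ h with x∈p∩q⁻ S _ h
        ... | s , h′ with x∈p∪q⁻ (verts T) (verts U) (p─q⊆p _ _ h′)
        ...   | inj₁ a = x∈p∪q⁺ (inj₁ (x∈p∩q⁺ (s , x∈p∧x∉q⇒x∈p─q a (x∈p─q⇒x∉q (verts T ∪ verts U) _ h′))))
        ...   | inj₂ b = x∈p∪q⁺ (inj₂ (x∈p∩q⁺ (s , b)))

        S≤2S : ∣ S ∣ ≤ 2 * ∣ S ∣
        S≤2S = m≤m+n ∣ S ∣ _

        go : Separator G w S ⊎ 3 * ∣ S ∩ hang T ∣ ≤ ∣ S ∣ →
             Separator G w S ⊎ 3 * ∣ S ∩ hang U ∣ ≤ ∣ S ∣ →
             Separator G w S ⊎ 3 * ∣ S ∩ hang (T ▷ U) ∣ ≤ ∣ S ∣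
        go (inj₁ s) _        = inj₁ s
        go (inj₂ _) (inj₁ s) = inj₁ s
        go (inj₂ a) (inj₂ b) with ≤-total ∣ S ∣ (3 * ∣ S ∩ verts U ∣)
        -- The root bag of `U` makes the difference: `hang U` is light while `verts U` is heavy, so
        -- little of `S` remains both inside and outside this cut.
        ... | inj₁ big = inj₁ (separator U clU (≤-trans b S≤2S) (heavy U big))
        ... | inj₂ small with ≤-total ∣ S ∣ (3 * ∣ S ∩ hang (T ▷ U) ∣)
        ...   | inj₂ small′ = inj₂ small′
        ...   | inj₁ big′   = inj₁ (separator (T ▷ U) cl inner′
                  (heavy (T ▷ U) (≤-trans big′ (*-monoʳ-≤ 3 (p⊆q⇒∣p∣≤∣q∣ (∩-monoʳ (p─q⊆p _ _)))))))
          where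
          open ≤-Reasoning
          inner′ : 3 * ∣ S ∩ hang (T ▷ U) ∣ ≤ 2 * ∣ S ∣
          inner′ = begin
            3 * ∣ S ∩ hang (T ▷ U) ∣                    ≤⟨ *-monoʳ-≤ 3 (p⊆q∪r⇒∣p∣≤∣q∣+∣r∣ hang⊆) ⟩
            3 * (∣ S ∩ hang T ∣ + ∣ S ∩ verts U ∣)      ≡⟨ *-distribˡ-+ 3 ∣ S ∩ hang T ∣ _ ⟩
            3 * ∣ S ∩ hang T ∣ + 3 * ∣ S ∩ verts U ∣    ≤⟨ +-mono-≤ a small ⟩
            ∣ S ∣ + ∣ S ∣                               ≡⟨ cong (∣ S ∣ +_) (≡-sym (+-identityʳ ∣ S ∣)) ⟩
            2 * ∣ S ∣                                   ∎

    balanced : Separator G w S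
    balanced with rooted
    ... | T , good , all∈ with search T good (λ {v} {u} _ e → let (i , b) = edgeIn D v u e in i , all∈ i , b)
    ...   | inj₁ s = s
    -- No cut was found on the way up, so the root bag of the whole tree is taken; nothing lies
    -- outside it and `hang T`.
    ...   | inj₂ small = separator T (λ {v} {u} _ e → let (i , b) = edgeIn D v u e in i , all∈ i , b)
                           (≤-trans small (m≤m+n ∣ S ∣ _))
                           (subst (λ z → 3 * z ≤ 2 * ∣ S ∣) (≡-sym (empty⇒∣p∣≡0 none)) z≤n)
      where
      none : ∀ v → v ∉ S ─ (hang T ∪ bag D (root T))
      none v h = let (i , b) = covers D v in
        x∈p─q⇒x∉q S _ h (verts⊆ T (∈verts⁺ T (all∈ i) b))

open Separators

-- Rational sums

module RationalSums where

  open import Data.Rational using (_+_; _*_; _-_; -_; _≤_)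
  open ℚₚ
  open ℚ-Solver using (solve; _:=_; _:+_; _:*_; _:-_; :-_; con)

  *-monoˡ : ∀ {c a b} → 0ℚ ≤ c → a ≤ b → c * a ≤ c * b
  *-monoˡ {c} h = *-monoˡ-≤-nonNeg c {{nonNegative h}}

  *-monoʳ : ∀ {c a b} → 0ℚ ≤ c → a ≤ b → a * c ≤ b * c
  *-monoʳ {c} h = *-monoʳ-≤-nonNeg c {{nonNegative h}}

  *-mono : ∀ {a b c d} → 0ℚ ≤ a → 0ℚ ≤ d → a ≤ b → c ≤ d → a * c ≤ b * d
  *-mono 0≤a 0≤d a≤b c≤d = ≤-trans (*-monoˡ 0≤a c≤d) (*-monoʳ 0≤d a≤b)

  0≤* : ∀ {a b} → 0ℚ ≤ a → 0ℚ ≤ b → 0ℚ ≤ a * b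
  0≤* {a} {b} p q = ≤-trans (≤-reflexive (≡-sym (*-zeroʳ a))) (*-monoˡ p q)

  0≤+ : ∀ {a b} → 0ℚ ≤ a → 0ℚ ≤ b → 0ℚ ≤ a + b
  0≤+ p q = ≤-trans (≤-reflexive (≡-sym (+-identityʳ 0ℚ))) (+-mono-≤ p q)

  sq : ℚ → ℚ
  sq x = x * x

  0≤sq : ∀ x → 0ℚ ≤ sq x
  0≤sq x with ≤-total 0ℚ x
  ... | inj₁ p = 0≤* p p
  ... | inj₂ p = ≤-trans (0≤* q q) (≤-reflexive (solve 1 (λ y → (con 0ℚ :- y) :* (con 0ℚ :- y) := y :* y) refl x))
    where
    q : 0ℚ ≤ 0ℚ - x
    q = ≤-trans (neg-antimono-≤ p) (≤-reflexive (≡-sym (+-identityˡ (- x))))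

  2ℚ : ℚ
  2ℚ = 1ℚ + 1ℚ

  0≤2 : 0ℚ ≤ 2ℚ
  0≤2 = nonNegative⁻¹ 2ℚ

  0≤1 : 0ℚ ≤ 1ℚ
  0≤1 = nonNegative⁻¹ 1ℚ

  ≤-by : ∀ {a b c} → 0ℚ ≤ c → a + c ≡ b → a ≤ b
  ≤-by {a} {b} {c} h e = ≤-trans (≤-reflexive (≡-sym (+-identityʳ a))) (≤-trans (+-monoʳ-≤ a h) (≤-reflexive e))

  -- The parallelogram law: the slack is the square of (a - b) - (b - c).
  sq-triangle : ∀ a b c → sq (a - c) ≤ 2ℚ * sq (a - b) + 2ℚ * sq (b - c)
  sq-triangle a b c = ≤-by (0≤sq ((a - b) - (b - c)))
    (solve 3 (λ a b c → (a :- c) :* (a :- c) :+ ((a :- b) :- (b :- c)) :* ((a :- b) :- (b :- c))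
       := con 2ℚ :* ((a :- b) :* (a :- b)) :+ con 2ℚ :* ((b :- c) :* (b :- c))) refl a b c)

  -- Recursion on the successor instead of a fraction, so that counting identities follow by
  -- induction along lists.
  ι : ℕ → ℚ
  ι zero    = 0ℚ
  ι (suc n) = 1ℚ + ι n

  0≤ι : ∀ n → 0ℚ ≤ ι n
  0≤ι zero    = ≤-refl
  0≤ι (suc n) = 0≤+ 0≤1 (0≤ι n)

  ι-+ : ∀ m n → ι (m ℕ.+ n) ≡ ι m + ι n
  ι-+ zero    n = ≡-sym (+-identityˡ (ι n))
  ι-+ (suc m) n = trans (cong (1ℚ +_) (ι-+ m n)) (≡-sym (+-assoc 1ℚ (ι m) (ι n)))

  ι-* : ∀ m n → ι (m ℕ.* n) ≡ ι m * ι n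
  ι-* zero    n = ≡-sym (*-zeroˡ (ι n))
  ι-* (suc m) n = trans (ι-+ n (m ℕ.* n)) (trans (cong (ι n +_) (ι-* m n))
    (solve 2 (λ a b → b :+ a :* b := (con 1ℚ :+ a) :* b) refl (ι m) (ι n)))

  ι-mono : ∀ {m n} → m ℕ.≤ n → ι m ≤ ι n
  ι-mono {n = n} z≤n = 0≤ι n
  ι-mono (s≤s h)     = +-monoʳ-≤ 1ℚ (ι-mono h)

  private
    toℚᵘ-ι : ∀ n → ℚ.toℚᵘ (ι n) ℚᵘ.≃ ℚᵘ.mkℚᵘ (ℤ.+ n) 0
    toℚᵘ-ι zero    = ℚᵘₚ.≃-refl
    toℚᵘ-ι (suc n) = ℚᵘₚ.≃-trans (toℚᵘ-homo-+ 1ℚ (ι n))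
      (ℚᵘₚ.≃-trans (ℚᵘₚ.+-congʳ (ℚ.toℚᵘ 1ℚ) (toℚᵘ-ι n))
        (ℚᵘ.*≡* (cong (ℤ._* (ℤ.+ 1)) (cong (ℤ._+_ (ℤ.+ 1)) (ℤₚ.*-identityʳ (ℤ.+ n))))))

  -- Unnormalised rationals avoid the gcd hidden in `inv`. The later identities for `inv` are
  -- derived from this one.
  inv-ι : ∀ k .{{_ : ℕ.NonZero k}} → inv k * ι k ≡ 1ℚ
  inv-ι (suc k) = toℚᵘ-injective (ℚᵘₚ.≃-trans (toℚᵘ-homo-* (inv (suc k)) (ι (suc k)))
    (ℚᵘₚ.≃-trans (ℚᵘₚ.*-cong (toℚᵘ-fromℚᵘ (ℚᵘ.mkℚᵘ (ℤ.+ 1) k)) (toℚᵘ-ι (suc k)))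
      (ℚᵘ.*≡* (trans (ℤₚ.*-identityʳ _) (trans (ℤₚ.*-identityˡ (ℤ.+ suc k))
        (≡-sym (trans (ℤₚ.*-identityˡ _) (cong (λ z → ℤ.+ suc z) (ℕₚ.*-identityʳ k)))))))))

  0≤inv : ∀ k → 0ℚ ≤ inv k
  0≤inv zero    = ≤-refl
  0≤inv (suc k) = nonNegative⁻¹ (inv (suc k)) {{normalize-nonNeg 1 (suc k)}}

  inv-unique : ∀ k .{{_ : ℕ.NonZero k}} x → x * ι k ≡ 1ℚ → inv k ≡ x
  inv-unique k x e = begin
    inv k              ≡⟨ ≡-sym (*-identityʳ (inv k)) ⟩
    inv k * 1ℚ         ≡⟨ cong (inv k *_) (≡-sym e) ⟩
    inv k * (x * ι k)  ≡⟨ solve 3 (λ a b c → a :* (b :* c) := b :* (a :* c)) refl (inv k) x (ι k) ⟩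
    x * (inv k * ι k)  ≡⟨ cong (x *_) (inv-ι k) ⟩
    x * 1ℚ             ≡⟨ *-identityʳ x ⟩
    x                  ∎
    where open ≡-Reasoning

  inv-* : ∀ a b .{{_ : ℕ.NonZero a}} .{{_ : ℕ.NonZero b}} → inv (a ℕ.* b) ≡ inv a * inv b
  inv-* a b = inv-unique (a ℕ.* b) {{ℕₚ.m*n≢0 a b}} (inv a * inv b) (begin
    (inv a * inv b) * ι (a ℕ.* b)   ≡⟨ cong ((inv a * inv b) *_) (ι-* a b) ⟩
    (inv a * inv b) * (ι a * ι b)   ≡⟨ solve 4 (λ p q r s → (p :* q) :* (r :* s) := (p :* r) :* (q :* s)) refl (inv a) (inv b) (ι a) (ι b) ⟩
    (inv a * ι a) * (inv b * ι b)   ≡⟨ cong₂ _*_ (inv-ι a) (inv-ι b) ⟩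
    1ℚ * 1ℚ                         ≡⟨ *-identityʳ 1ℚ ⟩
    1ℚ                              ∎)
    where open ≡-Reasoning

  cancel-ι : ∀ k .{{_ : ℕ.NonZero k}} {x y} → x * ι k ≤ y * ι k → x ≤ y
  cancel-ι k {x} {y} h = subst₂ _≤_ (e x) (e y) (*-monoʳ (0≤inv k) h)
    where
    e : ∀ z → (z * ι k) * inv k ≡ z
    e z = trans (solve 3 (λ z a b → (z :* a) :* b := z :* (b :* a)) refl z (ι k) (inv k))
                (trans (cong (z *_) (inv-ι k)) (*-identityʳ z))

  -- `NonZero a` guards against the convention that `inv 0` is 0.
  inv-anti : ∀ {a b} .{{_ : ℕ.NonZero a}} → a ℕ.≤ b → inv b ≤ inv a
  inv-anti {a} {suc b} h = cancel-ι (suc b) (≤-trans (≤-reflexive (trans (inv-ι (suc b)) (≡-sym (inv-ι a))))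
    (*-monoˡ (0≤inv a) (ι-mono h)))
  inv-anti {suc a} {zero} ()

  module _ {A : Set} where

    Σ-cong : ∀ (xs : List A) {f g} → (∀ {x} → x ∈ₗ xs → f x ≡ g x) → Σℚ xs f ≡ Σℚ xs g
    Σ-cong []       h = refl
    Σ-cong (x ∷ xs) h = cong₂ _+_ (h (here refl)) (Σ-cong xs (h ∘ there))

    Σ-mono : ∀ (xs : List A) {f g} → (∀ {x} → x ∈ₗ xs → f x ≤ g x) → Σℚ xs f ≤ Σℚ xs g
    Σ-mono []       h = ≤-refl
    Σ-mono (x ∷ xs) h = +-mono-≤ (h (here refl)) (Σ-mono xs (h ∘ there))

    Σ-zero : ∀ (xs : List A) → Σℚ xs (λ _ → 0ℚ) ≡ 0ℚ
    Σ-zero []       = refl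
    Σ-zero (x ∷ xs) = trans (+-identityˡ _) (Σ-zero xs)

    Σ-nonneg : ∀ (xs : List A) {f} → (∀ x → 0ℚ ≤ f x) → 0ℚ ≤ Σℚ xs f
    Σ-nonneg []       h = ≤-refl
    Σ-nonneg (x ∷ xs) h = 0≤+ (h x) (Σ-nonneg xs h)

    Σ-+ : ∀ (xs : List A) f g → Σℚ xs (λ x → f x + g x) ≡ Σℚ xs f + Σℚ xs g
    Σ-+ []       f g = refl
    Σ-+ (x ∷ xs) f g = trans (cong (f x + g x +_) (Σ-+ xs f g))
      (solve 4 (λ a b c d → a :+ b :+ (c :+ d) := a :+ c :+ (b :+ d)) refl (f x) (g x) (Σℚ xs f) (Σℚ xs g))

    Σ-*ˡ : ∀ (xs : List A) c f → Σℚ xs (λ x → c * f x) ≡ c * Σℚ xs f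
    Σ-*ˡ []       c f = ≡-sym (*-zeroʳ c)
    Σ-*ˡ (x ∷ xs) c f = trans (cong (c * f x +_) (Σ-*ˡ xs c f)) (≡-sym (*-distribˡ-+ c (f x) _))

    Σ-*ʳ : ∀ (xs : List A) c f → Σℚ xs (λ x → f x * c) ≡ Σℚ xs f * c
    Σ-*ʳ xs c f = trans (Σ-cong xs (λ {x} _ → *-comm (f x) c)) (trans (Σ-*ˡ xs c f) (*-comm c _))

    Σ-const : ∀ (xs : List A) c → Σℚ xs (λ _ → c) ≡ ι (length xs) * c
    Σ-const []       c = ≡-sym (*-zeroˡ c)
    Σ-const (x ∷ xs) c = trans (cong (c +_) (Σ-const xs c))
      (solve 2 (λ n c → c :+ n :* c := (con 1ℚ :+ n) :* c) refl (ι (length xs)) c)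

    term≤Σ : ∀ (xs : List A) {f x} → (∀ y → 0ℚ ≤ f y) → x ∈ₗ xs → f x ≤ Σℚ xs f
    term≤Σ (x ∷ xs) {f} h (here refl) = ≤-by (Σ-nonneg xs h) refl
    term≤Σ (y ∷ xs) {f} h (there m)   = ≤-trans (term≤Σ xs h m)
      (≤-by (h y) (+-comm (Σℚ xs f) (f y)))

    Σ-filter≤ : ∀ {P : A → Set} (P? : Decidable P) (xs : List A) {f} → (∀ x → 0ℚ ≤ f x) →
                Σℚ (filter P? xs) f ≤ Σℚ xs f
    Σ-filter≤ P? [] h = ≤-refl
    Σ-filter≤ P? (x ∷ xs) {f} h with does (P? x)
    ... | true  = +-monoʳ-≤ (f x) (Σ-filter≤ P? xs h)
    ... | false = ≤-trans (Σ-filter≤ P? xs h) (≤-by (h x) (+-comm (Σℚ xs f) (f x)))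

    Σ-if : ∀ {P : A → Set} (P? : Decidable P) (xs : List A) c →
           Σℚ xs (λ x → if does (P? x) then c else 0ℚ) ≡ ι (length (filter P? xs)) * c
    Σ-if P? [] c = ≡-sym (*-zeroˡ c)
    Σ-if P? (x ∷ xs) c with does (P? x)
    ... | true  = trans (cong (c +_) (Σ-if P? xs c))
      (solve 2 (λ n c → c :+ n :* c := (con 1ℚ :+ n) :* c) refl (ι (length (filter P? xs))) c)
    ... | false = trans (+-identityˡ _) (Σ-if P? xs c)

    -- Jensen's inequality for the square; the slack is the weighted variance of `a`.
    sq-mean≤ : ∀ (xs : List A) (w a : A → ℚ) → (∀ x → 0ℚ ≤ w x) → Σℚ xs w ≡ 1ℚ →
               sq (Σℚ xs (λ x → w x * a x)) ≤ Σℚ xs (λ x → w x * sq (a x))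
    sq-mean≤ xs w a 0≤w Σw = ≤-by (Σ-nonneg xs (λ x → 0≤* (0≤w x) (0≤sq (a x - mean)))) (begin
      sq mean + Σℚ xs (λ x → w x * sq (a x - mean))
        ≡⟨ cong (sq mean +_) (Σ-cong xs (λ {x} _ → expand (w x) (a x) mean)) ⟩
      sq mean + Σℚ xs (λ x → w x * sq (a x) + (w x * a x * (- (2ℚ * mean)) + w x * sq mean))
        ≡⟨ cong (sq mean +_) (Σ-+ xs (λ x → w x * sq (a x)) (λ x → w x * a x * (- (2ℚ * mean)) + w x * sq mean)) ⟩
      sq mean + (Q + Σℚ xs (λ x → w x * a x * (- (2ℚ * mean)) + w x * sq mean))
        ≡⟨ cong (λ z → sq mean + (Q + z)) (Σ-+ xs (λ x → w x * a x * (- (2ℚ * mean))) (λ x → w x * sq mean)) ⟩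
      sq mean + (Q + (Σℚ xs (λ x → w x * a x * (- (2ℚ * mean))) + Σℚ xs (λ x → w x * sq mean)))
        ≡⟨ cong₂ (λ y z → sq mean + (Q + (y + z))) (Σ-*ʳ xs (- (2ℚ * mean)) (λ x → w x * a x)) (trans (Σ-*ʳ xs (sq mean) w) (cong (_* sq mean) Σw)) ⟩
      sq mean + (Q + (mean * (- (2ℚ * mean)) + 1ℚ * sq mean))
        ≡⟨ solve 2 (λ m q → m :* m :+ (q :+ (m :* (:- (con 2ℚ :* m)) :+ con 1ℚ :* (m :* m))) := q) refl mean Q ⟩
      Q ∎)
      where
      open ≡-Reasoning
      mean Q : ℚ
      mean = Σℚ xs (λ x → w x * a x)
      Q = Σℚ xs (λ x → w x * sq (a x))
      expand : ∀ w a m → w * sq (a - m) ≡ w * sq a + (w * a * (- (2ℚ * m)) + w * sq m)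
      expand = solve 3 (λ w a m → w :* ((a :- m) :* (a :- m)) := w :* (a :* a) :+ (w :* a :* (:- (con 2ℚ :* m)) :+ w :* (m :* m))) refl

  Σ-swap : ∀ {A B : Set} (xs : List A) (ys : List B) (f : A → B → ℚ) →
           Σℚ xs (λ x → Σℚ ys (f x)) ≡ Σℚ ys (λ y → Σℚ xs (λ x → f x y))
  Σ-swap []       ys f = ≡-sym (Σ-zero ys)
  Σ-swap (x ∷ xs) ys f = trans (cong (Σℚ ys (f x) +_) (Σ-swap xs ys f)) (≡-sym (Σ-+ ys (f x) _))

open RationalSums

-- Dirichlet forms of kernels on a finite list of states

module Kernels where

  open import Data.Rational using (_+_; _*_; _-_; -_; _≤_)
  open ℚₚ
  open ℚ-Solver using (solve; _:=_; _:+_; _:*_; _:-_; :-_; con)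

  module Kernel {A : Set} (Ω : List A) where

    -- The Dirichlet form without the usual factor 1/2 and without the weight of the uniform
    -- measure. The comparisons are homogeneous, and the missing half shows up as `2ℚ` in
    -- `energy-dot`.
    energy : (A → A → ℚ) → (A → ℚ) → ℚ
    energy k f = Σℚ Ω λ σ → Σℚ Ω λ τ → k σ τ * sq (f σ - f τ)

    _⊙_ : (A → A → ℚ) → (A → A → ℚ) → A → A → ℚ
    (k ⊙ l) σ τ = Σℚ Ω λ ρ → k σ ρ * l ρ τ

    ap : (A → A → ℚ) → (A → ℚ) → A → ℚ
    ap k f σ = Σℚ Ω λ ρ → k σ ρ * f ρ

    norm² : (A → ℚ) → ℚ
    norm² f = Σℚ Ω λ σ → sq (f σ)

    -- Unlike symmetry, this is inherited by `⊙`, and it is what lets a factor be summed out from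
    -- either end of a product.
    record DoublyStochastic (k : A → A → ℚ) : Set where
      field
        nonneg : ∀ σ τ → 0ℚ ≤ k σ τ
        rows   : ∀ {σ} → σ ∈ₗ Ω → Σℚ Ω (λ τ → k σ τ) ≡ 1ℚ
        cols   : ∀ {τ} → τ ∈ₗ Ω → Σℚ Ω (λ σ → k σ τ) ≡ 1ℚ
    open DoublyStochastic public

    0≤energy : ∀ {k} → (∀ σ τ → 0ℚ ≤ k σ τ) → ∀ f → 0ℚ ≤ energy k f
    0≤energy {k} h f = Σ-nonneg Ω λ σ → Σ-nonneg Ω λ τ → 0≤* (h σ τ) (0≤sq (f σ - f τ))

    energy-mono : ∀ {k l c} → (∀ {σ τ} → σ ∈ₗ Ω → τ ∈ₗ Ω → k σ τ ≤ c * l σ τ) →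
                  ∀ f → energy k f ≤ c * energy l f
    energy-mono {k} {l} {c} h f = begin
      energy k f
        ≤⟨ Σ-mono Ω (λ {σ} σ∈ → Σ-mono Ω (λ {τ} τ∈ → *-monoʳ (0≤sq (f σ - f τ)) (h σ∈ τ∈))) ⟩
      Σℚ Ω (λ σ → Σℚ Ω λ τ → c * l σ τ * sq (f σ - f τ))
        ≡⟨ Σ-cong Ω (λ {σ} _ → trans (Σ-cong Ω (λ {τ} _ → *-assoc c (l σ τ) _)) (Σ-*ˡ Ω c (λ τ → l σ τ * sq (f σ - f τ)))) ⟩
      Σℚ Ω (λ σ → c * Σℚ Ω λ τ → l σ τ * sq (f σ - f τ))
        ≡⟨ Σ-*ˡ Ω c (λ σ → Σℚ Ω λ τ → l σ τ * sq (f σ - f τ)) ⟩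
      c * energy l f ∎
      where open ≤-Reasoning

    -- Summing over both ends first leaves a column sum times a row sum at the intermediate state,
    -- so a stochastic factor disappears.
    total-⊙ : ∀ k l → Σℚ Ω (λ σ → Σℚ Ω λ τ → (k ⊙ l) σ τ) ≡
              Σℚ Ω (λ ρ → Σℚ Ω (λ σ → k σ ρ) * Σℚ Ω (λ τ → l ρ τ))
    total-⊙ k l = begin
      Σℚ Ω (λ σ → Σℚ Ω λ τ → Σℚ Ω λ ρ → k σ ρ * l ρ τ)
        ≡⟨ Σ-cong Ω (λ {σ} _ → Σ-swap Ω Ω (λ τ ρ → k σ ρ * l ρ τ)) ⟩
      Σℚ Ω (λ σ → Σℚ Ω λ ρ → Σℚ Ω λ τ → k σ ρ * l ρ τ)
        ≡⟨ Σ-cong Ω (λ {σ} _ → Σ-cong Ω (λ {ρ} _ → Σ-*ˡ Ω (k σ ρ) (λ τ → l ρ τ))) ⟩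
      Σℚ Ω (λ σ → Σℚ Ω λ ρ → k σ ρ * Σℚ Ω λ τ → l ρ τ)
        ≡⟨ Σ-swap Ω Ω (λ σ ρ → k σ ρ * Σℚ Ω λ τ → l ρ τ) ⟩
      Σℚ Ω (λ ρ → Σℚ Ω λ σ → k σ ρ * Σℚ Ω λ τ → l ρ τ)
        ≡⟨ Σ-cong Ω (λ {ρ} _ → Σ-*ʳ Ω (Σℚ Ω λ τ → l ρ τ) (λ σ → k σ ρ)) ⟩
      Σℚ Ω (λ ρ → Σℚ Ω (λ σ → k σ ρ) * Σℚ Ω (λ τ → l ρ τ)) ∎
      where open ≡-Reasoning

    ⊙-doublyStochastic : ∀ {k l} → DoublyStochastic k → DoublyStochastic l → DoublyStochastic (k ⊙ l)
    ⊙-doublyStochastic {k} {l} K L = record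
      { nonneg = λ σ τ → Σ-nonneg Ω λ ρ → 0≤* (nonneg K σ ρ) (nonneg L ρ τ)
      ; rows = λ {σ} σ∈ → trans (Σ-swap Ω Ω (λ τ ρ → k σ ρ * l ρ τ))
          (trans (Σ-cong Ω (λ {ρ} ρ∈ → trans (Σ-*ˡ Ω (k σ ρ) (λ τ → l ρ τ))
                   (trans (cong (k σ ρ *_) (rows L ρ∈)) (*-identityʳ (k σ ρ)))))
            (rows K σ∈))
      ; cols = λ {τ} τ∈ → trans (Σ-swap Ω Ω (λ σ ρ → k σ ρ * l ρ τ))
          (trans (Σ-cong Ω (λ {ρ} ρ∈ → trans (Σ-*ʳ Ω (l ρ τ) (λ σ → k σ ρ))
                   (trans (cong (_* l ρ τ) (cols K ρ∈)) (*-identityˡ (l ρ τ)))))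
            (cols L τ∈))
      }

    -- `sq-triangle` is applied through the intermediate state. In the first leg the rows of `l` sum
    -- out, in the second the columns of `k`.
    energy-⊙ : ∀ {k l} → DoublyStochastic k → DoublyStochastic l → ∀ f →
               energy (k ⊙ l) f ≤ 2ℚ * energy k f + 2ℚ * energy l f
    energy-⊙ {k} {l} K L f = begin
      energy (k ⊙ l) f
        ≤⟨ Σ-mono Ω (λ {σ} _ → Σ-mono Ω (λ {τ} _ → pointwise σ τ)) ⟩
      Σℚ Ω (λ σ → Σℚ Ω λ τ → 2ℚ * (u ⊙ l) σ τ + 2ℚ * (k ⊙ v) σ τ)
        ≡⟨ Σ-cong Ω (λ {σ} _ → trans (Σ-+ Ω (λ τ → 2ℚ * (u ⊙ l) σ τ) (λ τ → 2ℚ * (k ⊙ v) σ τ))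
             (cong₂ _+_ (Σ-*ˡ Ω 2ℚ (λ τ → (u ⊙ l) σ τ)) (Σ-*ˡ Ω 2ℚ (λ τ → (k ⊙ v) σ τ)))) ⟩
      Σℚ Ω (λ σ → 2ℚ * Σℚ Ω (λ τ → (u ⊙ l) σ τ) + 2ℚ * Σℚ Ω (λ τ → (k ⊙ v) σ τ))
        ≡⟨ trans (Σ-+ Ω (λ σ → 2ℚ * Σℚ Ω (λ τ → (u ⊙ l) σ τ)) (λ σ → 2ℚ * Σℚ Ω (λ τ → (k ⊙ v) σ τ)))
             (cong₂ _+_ (Σ-*ˡ Ω 2ℚ (λ σ → Σℚ Ω (λ τ → (u ⊙ l) σ τ))) (Σ-*ˡ Ω 2ℚ (λ σ → Σℚ Ω (λ τ → (k ⊙ v) σ τ)))) ⟩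
      2ℚ * Σℚ Ω (λ σ → Σℚ Ω (λ τ → (u ⊙ l) σ τ)) + 2ℚ * Σℚ Ω (λ σ → Σℚ Ω (λ τ → (k ⊙ v) σ τ))
        ≡⟨ cong₂ (λ x y → 2ℚ * x + 2ℚ * y) first second ⟩
      2ℚ * energy k f + 2ℚ * energy l f ∎
      where
      open ≤-Reasoning
      d : A → A → ℚ
      d σ τ = sq (f σ - f τ)
      u v : A → A → ℚ
      u σ ρ = k σ ρ * d σ ρ
      v ρ τ = l ρ τ * d ρ τ
      pointwise : ∀ σ τ → (k ⊙ l) σ τ * d σ τ ≤ 2ℚ * (u ⊙ l) σ τ + 2ℚ * (k ⊙ v) σ τ
      pointwise σ τ = begin
        (k ⊙ l) σ τ * d σ τ
          ≡⟨ ≡-sym (Σ-*ʳ Ω (d σ τ) (λ ρ → k σ ρ * l ρ τ)) ⟩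
        Σℚ Ω (λ ρ → k σ ρ * l ρ τ * d σ τ)
          ≤⟨ Σ-mono Ω (λ {ρ} _ → *-monoˡ (0≤* (nonneg K σ ρ) (nonneg L ρ τ)) (sq-triangle (f σ) (f ρ) (f τ))) ⟩
        Σℚ Ω (λ ρ → k σ ρ * l ρ τ * (2ℚ * d σ ρ + 2ℚ * d ρ τ))
          ≡⟨ Σ-cong Ω (λ {ρ} _ → solve 5 (λ a b x y t → a :* b :* (t :* x :+ t :* y) := t :* (a :* x :* b) :+ t :* (a :* (b :* y)))
               refl (k σ ρ) (l ρ τ) (d σ ρ) (d ρ τ) 2ℚ) ⟩
        Σℚ Ω (λ ρ → 2ℚ * (u σ ρ * l ρ τ) + 2ℚ * (k σ ρ * v ρ τ))
          ≡⟨ trans (Σ-+ Ω (λ ρ → 2ℚ * (u σ ρ * l ρ τ)) (λ ρ → 2ℚ * (k σ ρ * v ρ τ)))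
               (cong₂ _+_ (Σ-*ˡ Ω 2ℚ (λ ρ → u σ ρ * l ρ τ)) (Σ-*ˡ Ω 2ℚ (λ ρ → k σ ρ * v ρ τ))) ⟩
        2ℚ * (u ⊙ l) σ τ + 2ℚ * (k ⊙ v) σ τ ∎
      first : Σℚ Ω (λ σ → Σℚ Ω (λ τ → (u ⊙ l) σ τ)) ≡ energy k f
      first = trans (total-⊙ u l) (trans (Σ-cong Ω (λ {ρ} ρ∈ →
        trans (cong (Σℚ Ω (λ σ → u σ ρ) *_) (rows L ρ∈)) (*-identityʳ (Σℚ Ω (λ σ → u σ ρ)))))
        (Σ-swap Ω Ω (λ ρ σ → u σ ρ)))
      second : Σℚ Ω (λ σ → Σℚ Ω (λ τ → (k ⊙ v) σ τ)) ≡ energy l f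
      second = trans (total-⊙ k v) (Σ-cong Ω (λ {ρ} ρ∈ →
        trans (cong (_* Σℚ Ω (λ τ → v ρ τ)) (cols K ρ∈)) (*-identityˡ (Σℚ Ω (λ τ → v ρ τ)))))

    dot : (A → ℚ) → (A → ℚ) → ℚ
    dot f g = Σℚ Ω λ σ → f σ * g σ

    -- Expanding the square, the two pure terms give `norm² f` each, one by rows and one by columns.
    energy-dot : ∀ {k} → DoublyStochastic k → ∀ f → energy k f + 2ℚ * dot f (ap k f) ≡ 2ℚ * norm² f
    energy-dot {k} K f = begin
      energy k f + 2ℚ * dot f (ap k f)
        ≡⟨ cong (energy k f +_) (≡-sym (Σ-*ˡ Ω 2ℚ (λ σ → f σ * ap k f σ))) ⟩
      energy k f + Σℚ Ω (λ σ → 2ℚ * (f σ * ap k f σ))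
        ≡⟨ ≡-sym (Σ-+ Ω (λ σ → Σℚ Ω λ τ → k σ τ * sq (f σ - f τ)) (λ σ → 2ℚ * (f σ * ap k f σ))) ⟩
      Σℚ Ω (λ σ → Σℚ Ω (λ τ → k σ τ * sq (f σ - f τ)) + 2ℚ * (f σ * ap k f σ))
        ≡⟨ Σ-cong Ω (λ {σ} _ → inner σ) ⟩
      Σℚ Ω (λ σ → Σℚ Ω (λ τ → k σ τ * sq (f σ)) + Σℚ Ω (λ τ → k σ τ * sq (f τ)))
        ≡⟨ Σ-+ Ω (λ σ → Σℚ Ω (λ τ → k σ τ * sq (f σ))) (λ σ → Σℚ Ω (λ τ → k σ τ * sq (f τ))) ⟩
      Σℚ Ω (λ σ → Σℚ Ω (λ τ → k σ τ * sq (f σ))) + Σℚ Ω (λ σ → Σℚ Ω (λ τ → k σ τ * sq (f τ)))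
        ≡⟨ cong₂ _+_
             (Σ-cong Ω (λ {σ} σ∈ → trans (Σ-*ʳ Ω (sq (f σ)) (λ τ → k σ τ)) (trans (cong (_* sq (f σ)) (rows K σ∈)) (*-identityˡ (sq (f σ))))))
             (trans (Σ-swap Ω Ω (λ σ τ → k σ τ * sq (f τ)))
               (Σ-cong Ω (λ {τ} τ∈ → trans (Σ-*ʳ Ω (sq (f τ)) (λ σ → k σ τ)) (trans (cong (_* sq (f τ)) (cols K τ∈)) (*-identityˡ (sq (f τ))))))) ⟩
      norm² f + norm² f
        ≡⟨ solve 1 (λ x → x :+ x := con 2ℚ :* x) refl (norm² f) ⟩
      2ℚ * norm² f ∎
      where
      open ≡-Reasoning
      inner : ∀ σ → Σℚ Ω (λ τ → k σ τ * sq (f σ - f τ)) + 2ℚ * (f σ * ap k f σ) ≡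
                    Σℚ Ω (λ τ → k σ τ * sq (f σ)) + Σℚ Ω (λ τ → k σ τ * sq (f τ))
      inner σ = begin
        Σℚ Ω (λ τ → k σ τ * sq (f σ - f τ)) + 2ℚ * (f σ * ap k f σ)
          ≡⟨ cong (Σℚ Ω (λ τ → k σ τ * sq (f σ - f τ)) +_)
               (trans (≡-sym (*-assoc 2ℚ (f σ) (ap k f σ))) (≡-sym (Σ-*ˡ Ω (2ℚ * f σ) (λ τ → k σ τ * f τ)))) ⟩
        Σℚ Ω (λ τ → k σ τ * sq (f σ - f τ)) + Σℚ Ω (λ τ → 2ℚ * f σ * (k σ τ * f τ))
          ≡⟨ ≡-sym (Σ-+ Ω (λ τ → k σ τ * sq (f σ - f τ)) (λ τ → 2ℚ * f σ * (k σ τ * f τ))) ⟩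
        Σℚ Ω (λ τ → k σ τ * sq (f σ - f τ) + 2ℚ * f σ * (k σ τ * f τ))
          ≡⟨ Σ-cong Ω (λ {τ} _ → solve 3 (λ k a b → k :* ((a :- b) :* (a :- b)) :+ con 2ℚ :* a :* (k :* b) := k :* (a :* a) :+ k :* (b :* b)) refl (k σ τ) (f σ) (f τ)) ⟩
        Σℚ Ω (λ τ → k σ τ * sq (f σ) + k σ τ * sq (f τ))
          ≡⟨ Σ-+ Ω (λ τ → k σ τ * sq (f σ)) (λ τ → k σ τ * sq (f τ)) ⟩
        Σℚ Ω (λ τ → k σ τ * sq (f σ)) + Σℚ Ω (λ τ → k σ τ * sq (f τ)) ∎

    -- A symmetric stochastic kernel of this kind is the orthogonal projection
    -- onto functions constant on the classes of an equivalence relation.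
    record Projection (k : A → A → ℚ) : Set where
      field
        doubly : DoublyStochastic k
        symm   : ∀ σ τ → k σ τ ≡ k τ σ
        idem   : ∀ σ ρ τ → k σ ρ * k ρ τ ≡ k σ ρ * k σ τ
    open Projection public

    -- ⟨kf, kf⟩ = ⟨f, kkf⟩ = ⟨f, kf⟩ by symmetry and idempotence. Pointwise, `idem` says that the
    -- averages of `f` at `σ` and `ρ` agree wherever `k ρ σ` is nonzero.
    norm²-ap : ∀ {k} → Projection k → ∀ f → norm² (ap k f) ≡ dot f (ap k f)
    norm²-ap {k} K f = begin
      Σℚ Ω (λ σ → ap k f σ * ap k f σ)
        ≡⟨ Σ-cong Ω (λ {σ} _ → ≡-sym (Σ-*ʳ Ω (ap k f σ) (λ ρ → k σ ρ * f ρ))) ⟩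
      Σℚ Ω (λ σ → Σℚ Ω λ ρ → k σ ρ * f ρ * ap k f σ)
        ≡⟨ Σ-cong Ω (λ {σ} _ → Σ-cong Ω (λ {ρ} _ → step₁ σ ρ)) ⟩
      Σℚ Ω (λ σ → Σℚ Ω λ ρ → k ρ σ * (f ρ * ap k f ρ))
        ≡⟨ Σ-swap Ω Ω (λ σ ρ → k ρ σ * (f ρ * ap k f ρ)) ⟩
      Σℚ Ω (λ ρ → Σℚ Ω λ σ → k ρ σ * (f ρ * ap k f ρ))
        ≡⟨ Σ-cong Ω (λ {ρ} ρ∈ → trans (Σ-*ʳ Ω (f ρ * ap k f ρ) (λ σ → k ρ σ))
             (trans (cong (_* (f ρ * ap k f ρ)) (rows (doubly K) ρ∈)) (*-identityˡ (f ρ * ap k f ρ)))) ⟩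
      dot f (ap k f) ∎
      where
      open ≡-Reasoning
      step₁ : ∀ σ ρ → k σ ρ * f ρ * ap k f σ ≡ k ρ σ * (f ρ * ap k f ρ)
      step₁ σ ρ = begin
        k σ ρ * f ρ * ap k f σ
          ≡⟨ cong (λ z → z * f ρ * ap k f σ) (symm K σ ρ) ⟩
        k ρ σ * f ρ * ap k f σ
          ≡⟨ solve 3 (λ a b c → a :* b :* c := b :* (a :* c)) refl (k ρ σ) (f ρ) (ap k f σ) ⟩
        f ρ * (k ρ σ * ap k f σ)
          ≡⟨ cong (f ρ *_) (≡-sym (Σ-*ˡ Ω (k ρ σ) (λ τ → k σ τ * f τ))) ⟩
        f ρ * Σℚ Ω (λ τ → k ρ σ * (k σ τ * f τ))
          ≡⟨ cong (f ρ *_) (Σ-cong Ω (λ {τ} _ → trans (≡-sym (*-assoc (k ρ σ) (k σ τ) (f τ)))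
               (trans (cong (_* f τ) (idem K ρ σ τ)) (*-assoc (k ρ σ) (k ρ τ) (f τ))))) ⟩
        f ρ * Σℚ Ω (λ τ → k ρ σ * (k ρ τ * f τ))
          ≡⟨ cong (f ρ *_) (Σ-*ˡ Ω (k ρ σ) (λ τ → k ρ τ * f τ)) ⟩
        f ρ * (k ρ σ * ap k f ρ)
          ≡⟨ solve 3 (λ a b c → b :* (a :* c) := a :* (b :* c)) refl (k ρ σ) (f ρ) (ap k f ρ) ⟩
        k ρ σ * (f ρ * ap k f ρ) ∎

    -- Pythagoras: the energy is twice the squared distance from `f` to its projection.
    energy-projection : ∀ {k} → Projection k → ∀ f → energy k f + 2ℚ * norm² (ap k f) ≡ 2ℚ * norm² f
    energy-projection {k} K f =
      trans (cong (λ z → energy k f + 2ℚ * z) (norm²-ap K f)) (energy-dot (doubly K) f)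

    -- Averages of projections

    module Average {V : Set} (vs : List V) (w : ℚ) (0≤w : 0ℚ ≤ w) (Σw : Σℚ vs (λ _ → w) ≡ 1ℚ)
                   (k : V → A → A → ℚ) (K : ∀ v → Projection (k v)) where

      average : A → A → ℚ
      average σ τ = Σℚ vs λ v → w * k v σ τ

      private
        ap-average : ∀ f σ → ap average f σ ≡ Σℚ vs (λ v → w * ap (k v) f σ)
        ap-average f σ = begin
          Σℚ Ω (λ τ → Σℚ vs (λ v → w * k v σ τ) * f τ)
            ≡⟨ Σ-cong Ω (λ {τ} _ → ≡-sym (Σ-*ʳ vs (f τ) (λ v → w * k v σ τ))) ⟩
          Σℚ Ω (λ τ → Σℚ vs (λ v → w * k v σ τ * f τ))
            ≡⟨ Σ-swap Ω vs (λ τ v → w * k v σ τ * f τ) ⟩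
          Σℚ vs (λ v → Σℚ Ω λ τ → w * k v σ τ * f τ)
            ≡⟨ Σ-cong vs (λ {v} _ → trans (Σ-cong Ω (λ {τ} _ → *-assoc w (k v σ τ) (f τ))) (Σ-*ˡ Ω w (λ τ → k v σ τ * f τ))) ⟩
          Σℚ vs (λ v → w * ap (k v) f σ) ∎
          where open ≡-Reasoning

      average-sym : ∀ σ τ → average σ τ ≡ average τ σ
      average-sym σ τ = Σ-cong vs λ {v} _ → cong (w *_) (symm (K v) σ τ)

      average-rows : ∀ {σ} → σ ∈ₗ Ω → Σℚ Ω (average σ) ≡ 1ℚ
      average-rows {σ} σ∈ = trans (Σ-swap Ω vs (λ τ v → w * k v σ τ))
        (trans (Σ-cong vs λ {v} _ → trans (Σ-*ˡ Ω w (λ τ → k v σ τ))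
                 (trans (cong (w *_) (rows (doubly (K v)) σ∈)) (*-identityʳ w)))
          Σw)

      -- By convexity the squared norm of the averaged function is at most the average of the
      -- squared norms, and each projection loses exactly half of its own energy.
      average-contracts : ∀ f → 2ℚ * norm² (ap average f) + w * Σℚ vs (λ v → energy (k v) f) ≤ 2ℚ * norm² f
      average-contracts f = begin
        2ℚ * norm² (ap average f) + w * D
          ≤⟨ +-monoˡ-≤ (w * D) (*-monoˡ 0≤2 jensen) ⟩
        2ℚ * (w * Q) + w * D
          ≡⟨ solve 4 (λ t w q d → t :* (w :* q) :+ w :* d := w :* (d :+ t :* q)) refl 2ℚ w Q D ⟩
        w * (D + 2ℚ * Q)
          ≡⟨ cong (w *_) (trans (cong (D +_) (≡-sym (Σ-*ˡ vs 2ℚ (λ v → norm² (ap (k v) f)))))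
               (≡-sym (Σ-+ vs (λ v → energy (k v) f) (λ v → 2ℚ * norm² (ap (k v) f))))) ⟩
        w * Σℚ vs (λ v → energy (k v) f + 2ℚ * norm² (ap (k v) f))
          ≡⟨ cong (w *_) (Σ-cong vs (λ {v} _ → energy-projection (K v) f)) ⟩
        w * Σℚ vs (λ v → 2ℚ * norm² f)
          ≡⟨ ≡-sym (Σ-*ˡ vs w (λ v → 2ℚ * norm² f)) ⟩
        Σℚ vs (λ v → w * (2ℚ * norm² f))
          ≡⟨ trans (Σ-*ʳ vs (2ℚ * norm² f) (λ _ → w)) (trans (cong (_* (2ℚ * norm² f)) Σw) (*-identityˡ (2ℚ * norm² f))) ⟩
        2ℚ * norm² f ∎
        where
        open ≤-Reasoning
        D Q : ℚ
        D = Σℚ vs (λ v → energy (k v) f)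
        Q = Σℚ vs (λ v → norm² (ap (k v) f))
        jensen : norm² (ap average f) ≤ w * Q
        jensen = begin
          Σℚ Ω (λ σ → sq (ap average f σ))
            ≡⟨ Σ-cong Ω (λ {σ} _ → cong sq (ap-average f σ)) ⟩
          Σℚ Ω (λ σ → sq (Σℚ vs (λ v → w * ap (k v) f σ)))
            ≤⟨ Σ-mono Ω (λ {σ} _ → sq-mean≤ vs (λ _ → w) (λ v → ap (k v) f σ) (λ _ → 0≤w) Σw) ⟩
          Σℚ Ω (λ σ → Σℚ vs (λ v → w * sq (ap (k v) f σ)))
            ≡⟨ Σ-swap Ω vs (λ σ v → w * sq (ap (k v) f σ)) ⟩
          Σℚ vs (λ v → Σℚ Ω λ σ → w * sq (ap (k v) f σ))
            ≡⟨ Σ-cong vs (λ {v} _ → Σ-*ˡ Ω w (λ σ → sq (ap (k v) f σ))) ⟩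
          Σℚ vs (λ v → w * norm² (ap (k v) f))
            ≡⟨ Σ-*ˡ vs w (λ v → norm² (ap (k v) f)) ⟩
          w * Q ∎

    -- Uniform resampling within equivalence classes

    module Class {_~_ : A → A → Set} (eq : IsEquivalence _~_) (_~?_ : ∀ σ τ → Dec (σ ~ τ)) where

      private module Eq = IsEquivalence eq

      class : A → List A
      class σ = filter (σ ~?_) Ω

      kernel : A → A → ℚ
      kernel σ τ = if does (σ ~? τ) then inv (length (class σ)) else 0ℚ

      class-nonempty : ∀ {σ} → σ ∈ₗ Ω → ℕ.NonZero (length (class σ))
      class-nonempty {σ} σ∈ with class σ | ∈-filter⁺ (σ ~?_) σ∈ Eq.refl
      ... | _ ∷ _ | _ = _

      class-cong : ∀ {σ τ} → σ ~ τ → class σ ≡ class τ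
      class-cong {σ} {τ} h = filter-≐ (σ ~?_) (τ ~?_) (Eq.trans (Eq.sym h) , Eq.trans h) Ω

      kernel-yes : ∀ {σ τ} → σ ~ τ → kernel σ τ ≡ inv (length (class σ))
      kernel-yes {σ} {τ} h rewrite dec-true (σ ~? τ) h = refl

      kernel-no : ∀ {σ τ} → ¬ (σ ~ τ) → kernel σ τ ≡ 0ℚ
      kernel-no {σ} {τ} h rewrite dec-false (σ ~? τ) h = refl

      kernel-sym : ∀ σ τ → kernel σ τ ≡ kernel τ σ
      kernel-sym σ τ with σ ~? τ
      ... | yes h = trans (cong (inv ∘ length) (class-cong h)) (≡-sym (kernel-yes (Eq.sym h)))
      ... | no ¬h = ≡-sym (kernel-no (¬h ∘ Eq.sym))

      0≤kernel : ∀ σ τ → 0ℚ ≤ kernel σ τ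
      0≤kernel σ τ with does (σ ~? τ)
      ... | true  = 0≤inv (length (class σ))
      ... | false = ≤-refl

      private
        kernel-rows : ∀ {σ} → σ ∈ₗ Ω → Σℚ Ω (λ τ → kernel σ τ) ≡ 1ℚ
        kernel-rows {σ} σ∈ = trans (Σ-if (σ ~?_) Ω (inv (length (class σ))))
          (trans (*-comm (ι (length (class σ))) _) (inv-ι (length (class σ)) {{class-nonempty σ∈}}))

        kernel-idem : ∀ σ ρ τ → kernel σ ρ * kernel ρ τ ≡ kernel σ ρ * kernel σ τ
        kernel-idem σ ρ τ with σ ~? ρ
        ... | no _  = trans (*-zeroˡ (kernel ρ τ)) (≡-sym (*-zeroˡ (kernel σ τ)))
        ... | yes h = cong (inv (length (class σ)) *_) (same (σ ~? τ))
          where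
          same : Dec (σ ~ τ) → kernel ρ τ ≡ kernel σ τ
          same (yes k) = trans (kernel-yes (Eq.trans (Eq.sym h) k))
            (trans (cong (inv ∘ length) (≡-sym (class-cong h))) (≡-sym (kernel-yes k)))
          same (no ¬k) = trans (kernel-no (¬k ∘ Eq.trans h)) (≡-sym (kernel-no ¬k))

      kernel-projection : Projection kernel
      kernel-projection = record
        { doubly = record
          { nonneg = 0≤kernel
          ; rows   = kernel-rows
          ; cols   = λ {τ} τ∈ → trans (Σ-cong Ω (λ {σ} _ → kernel-sym σ τ)) (kernel-rows τ∈)
          }
        ; symm = kernel-sym
        ; idem = kernel-idem
        }

open Kernels

-- List colourings

module ListColourings where

  open import Data.Nat using (_≤_; _*_; _+_; _^_)

  module _ {A : Set} where

    unique⊆⇒length≤ : ∀ {xs ys : List A} → Unique xs → (∀ {x} → x ∈ₗ xs → x ∈ₗ ys) → length xs ≤ length ys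
    unique⊆⇒length≤ {[]}     u       h = z≤n
    unique⊆⇒length≤ {x ∷ xs} (x∉ ∷ u) h with ∈-∃++ (h (here refl))
    ... | as , bs , refl = subst (suc (length xs) ≤_)
          (trans (cong suc (length-++ as)) (≡-sym (trans (length-++ as) (ℕₚ.+-suc (length as) (length bs)))))
          (s≤s (unique⊆⇒length≤ u rest))
      where
      rest : ∀ {y} → y ∈ₗ xs → y ∈ₗ as ++ bs
      rest y∈ with ∈-++⁻ as (h (there y∈))
      ... | inj₁ k           = ∈-++⁺ˡ k
      ... | inj₂ (here refl) = ⊥-elim (All.lookup x∉ y∈ refl)
      ... | inj₂ (there k)   = ∈-++⁺ʳ as k

    -- An injection of `xs` into `ys` is presented by its decoding map `g`. The counts of colourings
    -- below are injections of this kind.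
    unique-covered⇒length≤ : ∀ {B : Set} {xs : List A} {ys : List B} (g : B → A) → Unique xs →
      (∀ {x} → x ∈ₗ xs → ∃[ y ] (y ∈ₗ ys × x ≡ g y)) → length xs ≤ length ys
    unique-covered⇒length≤ {ys = ys} g u h = ℕₚ.≤-trans
      (unique⊆⇒length≤ u (λ x∈ → let (y , y∈ , e) = h x∈ in subst (_∈ₗ map g ys) (≡-sym e) (∈-map⁺ g y∈)))
      (ℕₚ.≤-reflexive (length-map g ys))

    length-filter-split : ∀ {P : A → Set} (P? : Decidable P) xs →
      length xs ≡ length (filter P? xs) + length (filter (¬? ∘ P?) xs)
    length-filter-split P? [] = refl
    length-filter-split P? (x ∷ xs) with does (P? x)
    ... | true  = cong suc (length-filter-split P? xs)
    ... | false = trans (cong suc (length-filter-split P? xs)) (≡-sym (ℕₚ.+-suc (length (filter P? xs)) _))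

  length-cartesianProductWith : ∀ {A B C : Set} (f : A → B → C) xs ys →
    length (cartesianProductWith f xs ys) ≡ length xs * length ys
  length-cartesianProductWith f []       ys = refl
  length-cartesianProductWith f (x ∷ xs) ys = trans (length-++ (map (f x) ys))
    (cong₂ _+_ (length-map (f x) ys) (length-cartesianProductWith f xs ys))

  concatMap-map : ∀ {A B C : Set} (f : A → B → C) xs ys →
    concatMap (λ x → map (f x) ys) xs ≡ cartesianProductWith f xs ys
  concatMap-map f []       ys = refl
  concatMap-map f (x ∷ xs) ys = cong (map (f x) ys ++_) (concatMap-map f xs ys)

  lookup-ext : ∀ {A : Set} {n} {σ τ : Vec A n} → (∀ u → lookup σ u ≡ lookup τ u) → σ ≡ τ
  lookup-ext {σ = σ} {τ} h = trans (≡-sym (tabulate∘lookup σ)) (trans (tabulate-cong h) (tabulate∘lookup τ))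

  assignments-suc : ∀ {n} (L : Fin (suc n) → List ℕ) →
    assignments L ≡ cartesianProductWith _∷_ (L zero) (assignments (λ v → L (suc v)))
  assignments-suc L = concatMap-map _∷_ (L zero) (assignments (λ v → L (suc v)))

  ∈-assignments⁺ : ∀ {n} (L : Fin n → List ℕ) {σ} → (∀ v → lookup σ v ∈ₗ L v) → σ ∈ₗ assignments L
  ∈-assignments⁺ {zero}  L {[]}    h = here refl
  ∈-assignments⁺ {suc n} L {c ∷ σ} h = subst (c ∷ σ ∈ₗ_) (≡-sym (assignments-suc L))
    (∈-cartesianProductWith⁺ _∷_ (h zero) (∈-assignments⁺ (λ v → L (suc v)) (h ∘ suc)))

  ∈-assignments⁻ : ∀ {n} (L : Fin n → List ℕ) {σ} → σ ∈ₗ assignments L → ∀ v → lookup σ v ∈ₗ L v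
  ∈-assignments⁻ {suc n} L {σ} σ∈ v
    with ∈-cartesianProductWith⁻ _∷_ (L zero) (assignments (λ v → L (suc v))) (subst (σ ∈ₗ_) (assignments-suc L) σ∈) | v
  ... | c , σ′ , c∈ , σ∈′ , refl | zero  = c∈
  ... | c , σ′ , c∈ , σ∈′ , refl | suc w = ∈-assignments⁻ (λ v → L (suc v)) σ∈′ w

  assignments-unique : ∀ {n} (L : Fin n → List ℕ) → (∀ v → Unique (L v)) → Unique (assignments L)
  assignments-unique {zero}  L u = All.[] ∷ []
  assignments-unique {suc n} L u = subst Unique (≡-sym (assignments-suc L))
    (Uniq.cartesianProductWith⁺ _∷_ ∷-injective (u zero) (assignments-unique (λ v → L (suc v)) (u ∘ suc)))

  length-assignments≤ : ∀ {n} (L : Fin n → List ℕ) {q} → (∀ v → length (L v) ≤ q) → length (assignments L) ≤ q ^ n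
  length-assignments≤ {zero}  L h = ℕₚ.≤-refl
  length-assignments≤ {suc n} L h =
    ℕₚ.≤-trans (ℕₚ.≤-reflexive (trans (cong length (assignments-suc L))
                 (length-cartesianProductWith _∷_ (L zero) (assignments (λ v → L (suc v))))))
               (ℕₚ.*-mono-≤ (h zero) (length-assignments≤ (λ v → L (suc v)) (h ∘ suc)))

  module Colourings {n} (G : Graph n) (L : Fin n → List ℕ) (L-unique : ∀ v → Unique (L v)) where

    adj-sym : ∀ {u v} → Adjacent G u v → Adjacent G v u
    adj-sym {u} {v} = subst T (sym G u v)

    adj-irrefl : ∀ {v} → ¬ Adjacent G v v
    adj-irrefl {v} = subst T (irrefl G v)

    private
      T-not : ∀ {b} → T (not b) → ¬ T b
      T-not {false} _ ()

      not-T : ∀ {b} → ¬ T b → T (not b)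
      not-T {false} _ = _
      not-T {true}  h = ⊥-elim (h _)

    Ω-unique : Unique (Ω G L)
    Ω-unique = Uniq.filter⁺ (T? ∘ properᵇ G) (assignments-unique L L-unique)

    ∈Ω⁺ : ∀ {σ} → IsListColouring G L σ → σ ∈ₗ Ω G L
    ∈Ω⁺ {σ} (lists , proper) = ∈-filter⁺ (T? ∘ properᵇ G) (∈-assignments⁺ L lists)
      (all⁻ (λ u → all (ok u) (allFin n)) {xs = allFin n}
        (All.tabulate λ {u} _ → all⁻ (ok u) {xs = allFin n} (All.tabulate λ {v} _ → edge u v)))
      where
      ok : Fin n → Fin n → Bool
      ok u v = not (adj G u v) ∨ not (lookup σ u ℕ.≡ᵇ lookup σ v)
      edge : ∀ u v → T (ok u v)
      edge u v with adj G u v in e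
      ... | false = _
      ... | true  = not-T (λ eq → proper u v (subst T (≡-sym e) _) (ℕₚ.≡ᵇ⇒≡ _ _ eq))

    ∈Ω⁻ : ∀ {σ} → σ ∈ₗ Ω G L → IsListColouring G L σ
    ∈Ω⁻ {σ} σ∈ with ∈-filter⁻ (T? ∘ properᵇ G) σ∈
    ... | σ∈A , pr = ∈-assignments⁻ L σ∈A , λ u v e eq →
          [ (λ h → T-not h e) , (λ h → T-not h (ℕₚ.≡⇒≡ᵇ _ _ eq)) ]′
            (to T-∨ (All.lookup (all⁺ _ (allFin n) (All.lookup (all⁺ _ (allFin n) pr) (∈-allFin u))) (∈-allFin v)))

    -- A record rather than a function type, so that unification recovers `σ`, `v` and `c`; `Agree`
    -- below is a record for the same reason.
    record Free (σ : Colouring n) (v : Fin n) (c : ℕ) : Set where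
      constructor mkFree
      field free : ∀ u → Adjacent G v u → lookup σ u ≢ c
    open Free public

    recolour : ∀ {σ v c} → σ ∈ₗ Ω G L → c ∈ₗ L v → Free σ v c → (σ [ v ]≔ c) ∈ₗ Ω G L
    recolour {σ} {v} {c} σ∈ c∈ fr with ∈Ω⁻ σ∈
    ... | lists , proper = ∈Ω⁺ (lists′ , proper′)
      where
      lists′ : ∀ u → lookup (σ [ v ]≔ c) u ∈ₗ L u
      lists′ u with u ≟ᶠ v
      ... | yes refl rewrite lookup∘update u σ c = c∈
      ... | no  u≢v  rewrite lookup∘update′ u≢v σ c = lists u
      proper′ : ∀ u w → Adjacent G u w → lookup (σ [ v ]≔ c) u ≢ lookup (σ [ v ]≔ c) w
      proper′ u w e with u ≟ᶠ v | w ≟ᶠ v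
      ... | yes refl | yes refl = ⊥-elim (adj-irrefl e)
      ... | yes refl | no  w≢v rewrite lookup∘update u σ c | lookup∘update′ w≢v σ c = free fr w e ∘ ≡-sym
      ... | no  u≢v  | yes refl rewrite lookup∘update w σ c | lookup∘update′ u≢v σ c = free fr u (adj-sym e)
      ... | no  u≢v  | no  w≢v rewrite lookup∘update′ u≢v σ c | lookup∘update′ w≢v σ c = proper u w e

    ∈-available⁺ : ∀ σ v {c} → c ∈ₗ L v → Free σ v c → c ∈ₗ available G L σ v
    ∈-available⁺ σ v {c} c∈ fr = ∈-filter⁺ _ c∈ (not-T λ h →
      let (u , _ , k) = find (any⁻ _ (allFin n) h) ; (e , eq) = to T-∧ k in free fr u e (ℕₚ.≡ᵇ⇒≡ _ _ eq))

    ∈-available⁻ : ∀ σ v {c} → c ∈ₗ available G L σ v → c ∈ₗ L v × Free σ v c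
    ∈-available⁻ σ v {c} h with ∈-filter⁻ _ {xs = L v} h
    ... | c∈ , k = c∈ , mkFree λ u e eq →
          T-not k (any⁺ _ (lose (∈-allFin u) (from T-∧ (e , ℕₚ.≡⇒≡ᵇ _ _ eq))))

    available-unique : ∀ σ v → Unique (available G L σ v)
    available-unique σ v = Uniq.filter⁺ _ (L-unique v)

    -- Every blocked colour is the colour of some neighbour, so at most `deg G v` colours are
    -- blocked.
    length-L≤ : ∀ σ v → length (L v) ≤ length (available G L σ v) + deg G v
    length-L≤ σ v = ℕₚ.≤-trans (ℕₚ.≤-reflexive (length-filter-split _ (L v)))
      (ℕₚ.+-monoʳ-≤ (length (available G L σ v))
        (unique-covered⇒length≤ (lookup σ) (Uniq.filter⁺ _ (L-unique v)) blocked))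
      where
      blocked : ∀ {c} → c ∈ₗ filter _ (L v) → ∃[ u ] (u ∈ₗ filterᵇ (adj G v) (allFin n) × c ≡ lookup σ u)
      blocked {c} h with ∈-filter⁻ _ {xs = L v} h
      ... | _ , k with T? (any (λ u → adj G v u ∧ (lookup σ u ℕ.≡ᵇ c)) (allFin n))
      ...   | no ¬t = ⊥-elim (k (not-T ¬t))
      ...   | yes t = let (u , u∈ , s) = find (any⁻ _ (allFin n) t) ; (e , eq) = to T-∧ s in
                      u , ∈-filter⁺ _ u∈ e , ≡-sym (ℕₚ.≡ᵇ⇒≡ _ _ eq)

    other-colour : ∀ σ v c → deg G v + 2 ≤ length (L v) → ∃[ c′ ] (c′ ∈ₗ available G L σ v × c′ ≢ c)
    other-colour σ v c h = pick (available G L σ v) (available-unique σ v) two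
      where
      two : 2 ≤ length (available G L σ v)
      two = ℕₚ.+-cancelʳ-≤ (deg G v) 2 _ (ℕₚ.≤-trans (ℕₚ.≤-reflexive (ℕₚ.+-comm 2 (deg G v))) (ℕₚ.≤-trans h (length-L≤ σ v)))
      pick : ∀ cs → Unique cs → 2 ≤ length cs → ∃[ c′ ] (c′ ∈ₗ cs × c′ ≢ c)
      pick (a ∷ b ∷ cs) ((a≢b All.∷ _) ∷ _) _ with a ℕ.≟ c
      ... | no  a≢c  = a , here refl , a≢c
      ... | yes refl = b , there (here refl) , a≢b ∘ ≡-sym
      pick (a ∷ []) _ (s≤s ())

    record Agree (S : Subset n) (σ τ : Colouring n) : Set where
      constructor agree
      field off : ∀ u → u ∉ S → lookup σ u ≡ lookup τ u
    open Agree public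

    agree? : ∀ S σ τ → Dec (Agree S σ τ)
    agree? S σ τ = map′ agree off (all? λ u → ¬? (u ∈? S) →-dec (lookup σ u ℕ.≟ lookup τ u))

    agree-sym : ∀ {S σ τ} → Agree S σ τ → Agree S τ σ
    agree-sym h = agree λ u u∉ → ≡-sym (off h u u∉)

    agree-trans : ∀ {S σ τ ρ} → Agree S σ τ → Agree S τ ρ → Agree S σ ρ
    agree-trans h k = agree λ u u∉ → trans (off h u u∉) (off k u u∉)

    agree-equivalence : ∀ S → IsEquivalence (Agree S)
    agree-equivalence S = record { refl = agree λ _ _ → refl ; sym = agree-sym ; trans = agree-trans }

    agree-mono : ∀ {S S′ σ τ} → S ⊆ S′ → Agree S σ τ → Agree S′ σ τ
    agree-mono sub h = agree λ u u∉ → off h u (u∉ ∘ sub)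

    agree-update : ∀ {S} σ {v} c → v ∈ S → Agree S (σ [ v ]≔ c) σ
    agree-update {S} σ {v} c v∈ = agree λ u u∉ → lookup∘update′ (λ { refl → u∉ v∈ }) σ c

    merge : Subset n → Colouring n → Colouring n → Colouring n
    merge A α β = tabulate λ u → if does (u ∈? A) then lookup α u else lookup β u

    merge-in : ∀ {A u} α β → u ∈ A → lookup (merge A α β) u ≡ lookup α u
    merge-in {A} {u} α β h rewrite lookup∘tabulate (λ u → if does (u ∈? A) then lookup α u else lookup β u) u with u ∈? A
    ... | yes _ = refl
    ... | no ¬h = ⊥-elim (¬h h)

    merge-out : ∀ {A u} α β → u ∉ A → lookup (merge A α β) u ≡ lookup β u
    merge-out {A} {u} α β h rewrite lookup∘tabulate (λ u → if does (u ∈? A) then lookup α u else lookup β u) u with u ∈? A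
    ... | yes k = ⊥-elim (h k)
    ... | no  _ = refl

    -- Only edges across the boundary of `A` mix the two colourings. There `α` and `β` agree at the
    -- outer end, so properness of `α` decides.
    merge-valid : ∀ {A α β} → α ∈ₗ Ω G L → β ∈ₗ Ω G L →
                  (∀ {u w} → u ∈ A → w ∉ A → Adjacent G u w → lookup α w ≡ lookup β w) →
                  merge A α β ∈ₗ Ω G L
    merge-valid {A} {α} {β} α∈ β∈ cross with ∈Ω⁻ α∈ | ∈Ω⁻ β∈
    ... | lα , pα | lβ , pβ = ∈Ω⁺ (lists , proper)
      where
      lists : ∀ u → lookup (merge A α β) u ∈ₗ L u
      lists u with u ∈? A
      ... | yes h rewrite merge-in α β h  = lα u
      ... | no  h rewrite merge-out α β h = lβ u
      proper : ∀ u w → Adjacent G u w → lookup (merge A α β) u ≢ lookup (merge A α β) w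
      proper u w e with u ∈? A | w ∈? A
      ... | yes h | yes k rewrite merge-in α β h | merge-in α β k = pα u w e
      ... | yes h | no  k rewrite merge-in α β h | merge-out α β k = λ eq →
            pα u w e (trans eq (≡-sym (cross h k e)))
      ... | no  h | yes k rewrite merge-out α β h | merge-in α β k = λ eq →
            pα u w e (trans (cross k h (adj-sym e)) eq)
      ... | no  h | no  k rewrite merge-out α β h | merge-out α β k = pβ u w e

open ListColourings

-- The Poincaré inequality and mixing of the Glauber dynamics

module GlauberMixing where

  open import Data.Rational using (_+_; _*_; _-_; -_; _≤_)
  open ℚₚ
  open ℚ-Solver using (solve; _:=_; _:+_; _:*_; _:-_; :-_; con)

  -- Geometric decay from proportional drops

  module Decay (b : ℕ → ℚ) (0≤b : ∀ s → 0ℚ ≤ b s) (M : ℕ) {{_ : ℕ.NonZero M}}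
               (drop : ∀ s → ι M * b (suc s) + b s ≤ ι M * b s) where

    private
      b-antitone : ∀ s → b (suc s) ≤ b s
      b-antitone s = cancel-ι M (begin
        b (suc s) * ι M        ≤⟨ ≤-by (0≤b s) (cong (_+ b s) (*-comm (b (suc s)) (ι M))) ⟩
        ι M * b (suc s) + b s  ≤⟨ drop s ⟩
        ι M * b s              ≡⟨ *-comm (ι M) (b s) ⟩
        b s * ι M              ∎)
        where open ≤-Reasoning

      -- The drops of `j` successive steps add up, and each is at least the final value because `b`
      -- decreases. At `j` = `M` this halves `b`, with no estimate of (1 - 1/M)^M.
      accumulate : ∀ j s → ι M * b (j ℕ.+ s) + ι j * b (j ℕ.+ s) ≤ ι M * b s
      accumulate zero    s = ≤-reflexive (trans (cong (ι M * b s +_) (*-zeroˡ (b s))) (+-identityʳ (ι M * b s)))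
      accumulate (suc j) s = begin
        ι M * b (suc (j ℕ.+ s)) + ι (suc j) * b (suc (j ℕ.+ s))
          ≤⟨ +-monoʳ-≤ (ι M * b (suc (j ℕ.+ s))) (*-monoˡ (0≤ι (suc j)) (b-antitone (j ℕ.+ s))) ⟩
        ι M * b (suc (j ℕ.+ s)) + (1ℚ + ι j) * b (j ℕ.+ s)
          ≡⟨ solve 3 (λ x j y → x :+ (con 1ℚ :+ j) :* y := (x :+ y) :+ j :* y) refl (ι M * b (suc (j ℕ.+ s))) (ι j) (b (j ℕ.+ s)) ⟩
        (ι M * b (suc (j ℕ.+ s)) + b (j ℕ.+ s)) + ι j * b (j ℕ.+ s)
          ≤⟨ +-monoˡ-≤ (ι j * b (j ℕ.+ s)) (drop (j ℕ.+ s)) ⟩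
        ι M * b (j ℕ.+ s) + ι j * b (j ℕ.+ s)
          ≤⟨ accumulate j s ⟩
        ι M * b s ∎
        where open ≤-Reasoning

      halve : ∀ s → 2ℚ * b (M ℕ.+ s) ≤ b s
      halve s = cancel-ι M (≤-trans (≤-reflexive
        (solve 2 (λ m x → con 2ℚ :* x :* m := m :* x :+ m :* x) refl (ι M) (b (M ℕ.+ s))))
        (≤-trans (accumulate M s) (≤-reflexive (*-comm (ι M) (b s)))))

    decay : ∀ j → ι (2 ℕ.^ j) * b (j ℕ.* M) ≤ b 0
    decay zero    = ≤-reflexive (*-identityˡ (b 0))
    decay (suc j) = begin
      ι (2 ℕ.^ suc j) * b (M ℕ.+ j ℕ.* M)
        ≡⟨ cong (_* b (M ℕ.+ j ℕ.* M)) (ι-* 2 (2 ℕ.^ j)) ⟩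
      ι 2 * ι (2 ℕ.^ j) * b (M ℕ.+ j ℕ.* M)
        ≡⟨ solve 2 (λ x y → con (ι 2) :* x :* y := x :* (con 2ℚ :* y)) refl (ι (2 ℕ.^ j)) (b (M ℕ.+ j ℕ.* M)) ⟩
      ι (2 ℕ.^ j) * (2ℚ * b (M ℕ.+ j ℕ.* M))
        ≤⟨ *-monoˡ (0≤ι (2 ℕ.^ j)) (halve (j ℕ.* M)) ⟩
      ι (2 ℕ.^ j) * b (j ℕ.* M)
        ≤⟨ decay j ⟩
      b 0 ∎
      where open ≤-Reasoning

  sq≤1⇒≤1 : ∀ {z} → 0ℚ ≤ z → sq z ≤ 1ℚ → z ≤ 1ℚ
  sq≤1⇒≤1 {z} 0≤z h with ≤-total z 1ℚ
  ... | inj₁ k = k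
  ... | inj₂ k = ≤-trans (≤-reflexive (≡-sym (*-identityʳ z))) (≤-trans (*-monoˡ 0≤z k) h)

  sq-∣∣ : ∀ x → sq ℚ.∣ x ∣ ≡ sq x
  sq-∣∣ x with ∣p∣≡p∨∣p∣≡-p x
  ... | inj₁ e = cong sq e
  ... | inj₂ e = trans (cong sq e) (solve 1 (λ x → (:- x) :* (:- x) := x :* x) refl x)

  module Glauber {n} (G : Graph n) (L : Fin n → List ℕ) (L-unique : ∀ v → Unique (L v))
               (Δ q : ℕ) (deg≤Δ : ∀ v → deg G v ℕ.≤ Δ)
               (deg+2≤L : ∀ v → deg G v ℕ.+ 2 ℕ.≤ length (L v)) (L≤q : ∀ v → length (L v) ℕ.≤ q) where

    open Colourings G L L-unique public
    open Kernel (Ω G L) public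
    module Cl (S : Subset n) = Class (agree-equivalence S) (agree? S)
    open Cl public using (class; class-nonempty; class-cong; kernel-yes; kernel-no; 0≤kernel; kernel-projection)

    ker : Subset n → Colouring n → Colouring n → ℚ
    ker S = Cl.kernel S

    ker-doubly : ∀ S → DoublyStochastic (ker S)
    ker-doubly S = doubly (kernel-projection S)

    ∈class⁺ : ∀ S σ {ρ} → ρ ∈ₗ Ω G L → Agree S σ ρ → ρ ∈ₗ class S σ
    ∈class⁺ S σ = ∈-filter⁺ (agree? S σ)

    ∈class⁻ : ∀ S σ {ρ} → ρ ∈ₗ class S σ → ρ ∈ₗ Ω G L × Agree S σ ρ
    ∈class⁻ S σ = ∈-filter⁻ (agree? S σ)

    class-unique : ∀ S σ → Unique (class S σ)
    class-unique S σ = Uniq.filter⁺ (agree? S σ) Ω-unique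

    free-at : ∀ {σ} v → σ ∈ₗ Ω G L → Free σ v (lookup σ v)
    free-at v σ∈ = mkFree λ u e eq → proj₂ (∈Ω⁻ σ∈) v u e (≡-sym eq)

    free-cong : ∀ {σ τ v c} → Agree ⁅ v ⁆ σ τ → Free τ v c → Free σ v c
    free-cong {v = v} h fr = mkFree λ u e eq → free fr u e (trans (≡-sym (off h u (u∉ e))) eq)
      where
      u∉ : ∀ {u} → Adjacent G v u → u ∉ ⁅ v ⁆
      u∉ e k with x∈⁅y⁆⇒x≡y v k
      ... | refl = adj-irrefl e

    update-agree : ∀ {σ τ v} → Agree ⁅ v ⁆ σ τ → τ ≡ σ [ v ]≔ lookup τ v
    update-agree {σ} {τ} {v} h = lookup-ext eq
      where
      eq : ∀ u → lookup τ u ≡ lookup (σ [ v ]≔ lookup τ v) u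
      eq u with u ≟ᶠ v
      ... | yes refl = ≡-sym (lookup∘update u σ (lookup τ u))
      ... | no  u≢v  = trans (≡-sym (off h u (u≢v ∘ x∈⁅y⁆⇒x≡y v))) (≡-sym (lookup∘update′ u≢v σ (lookup τ v)))

    agree-at : ∀ σ v c → Agree ⁅ v ⁆ σ (σ [ v ]≔ c)
    agree-at σ v c = agree-sym (agree-update σ c (x∈⁅x⁆ v))

    -- Recolouring `v` and reading off the colour at `v` are mutually inverse. This identifies a
    -- Glauber update with resampling in the class.
    length-class-singleton : ∀ {σ} v → σ ∈ₗ Ω G L → length (class ⁅ v ⁆ σ) ≡ length (available G L σ v)
    length-class-singleton {σ} v σ∈ = ℕₚ.≤-antisym
      (unique-covered⇒length≤ {ys = available G L σ v} (σ [ v ]≔_) (class-unique ⁅ v ⁆ σ) λ {τ} τ∈ →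
        let (τ∈Ω , h) = ∈class⁻ ⁅ v ⁆ σ τ∈ in
        lookup τ v , ∈-available⁺ σ v (proj₁ (∈Ω⁻ τ∈Ω) v) (free-cong h (free-at v τ∈Ω)) , update-agree h)
      (unique-covered⇒length≤ {ys = class ⁅ v ⁆ σ} (λ τ → lookup τ v) (available-unique σ v) λ {c} c∈ →
        let (c∈L , fr) = ∈-available⁻ σ v c∈ in
        σ [ v ]≔ c , ∈class⁺ ⁅ v ⁆ σ (recolour σ∈ c∈L fr) (agree-at σ v c) , ≡-sym (lookup∘update v σ c))

    length-class-singleton≤q : ∀ {σ} v → σ ∈ₗ Ω G L → length (class ⁅ v ⁆ σ) ℕ.≤ q
    length-class-singleton≤q {σ} v σ∈ = ℕₚ.≤-trans (ℕₚ.≤-reflexive (length-class-singleton v σ∈))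
      (ℕₚ.≤-trans (length-filter _ (L v)) (L≤q v))

    private
      T-bool : ∀ {a b} → (T a → T b) → (T b → T a) → a ≡ b
      T-bool {true}  {true}  f g = refl
      T-bool {false} {false} f g = refl
      T-bool {true}  {false} f g = ⊥-elim (f _)
      T-bool {false} {true}  f g = ⊥-elim (g _)

      does⇒ : ∀ {P : Set} (d : Dec P) → T (does d) → P
      does⇒ (yes p) _ = p

    agreeOff⁻ : ∀ {v σ τ} → T (agreeOff v σ τ) → Agree ⁅ v ⁆ σ τ
    off (agreeOff⁻ {v} {σ} {τ} h) u u∉ with to T-∨ (All.lookup (all⁺ _ (allFin n) h) (∈-allFin u))
    ... | inj₁ k = ⊥-elim (u∉ (subst (_∈ ⁅ v ⁆) (≡-sym (toWitness k)) (x∈⁅x⁆ v)))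
    ... | inj₂ k = ℕₚ.≡ᵇ⇒≡ _ _ k

    agreeOff⁺ : ∀ {v σ τ} → Agree ⁅ v ⁆ σ τ → T (agreeOff v σ τ)
    agreeOff⁺ {v} {σ} {τ} h = all⁻ (λ u → ⌊ u ≟ᶠ v ⌋ ∨ (lookup σ u ℕ.≡ᵇ lookup τ u)) {xs = allFin n} (All.tabulate λ {u} _ → at u)
      where
      at : ∀ u → T (⌊ u ≟ᶠ v ⌋ ∨ (lookup σ u ℕ.≡ᵇ lookup τ u))
      at u with u ≟ᶠ v
      ... | yes _  = _
      ... | no u≢v = ℕₚ.≡⇒≡ᵇ _ _ (off h u (u≢v ∘ x∈⁅y⁆⇒x≡y v))

    -- For proper `τ` the colour test follows from the agreement test: `τ` uses its own colour at
    -- `v` legally, and `σ` has the same neighbours' colours.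
    glauber-term : ∀ {σ τ} v → σ ∈ₗ Ω G L → τ ∈ₗ Ω G L →
      (if agreeOff v σ τ ∧ any (λ c → c ℕ.≡ᵇ lookup τ v) (available G L σ v)
       then inv n * inv (length (available G L σ v)) else 0ℚ) ≡ inv n * ker ⁅ v ⁆ σ τ
    glauber-term {σ} {τ} v σ∈ τ∈ = trans (cong (λ b → if b then inv n * inv (length (available G L σ v)) else 0ℚ) test) value
      where
      test : agreeOff v σ τ ∧ any (λ c → c ℕ.≡ᵇ lookup τ v) (available G L σ v) ≡ does (agree? ⁅ v ⁆ σ τ)
      test = T-bool
        (λ h → subst T (≡-sym (dec-true (agree? ⁅ v ⁆ σ τ) (agreeOff⁻ {v} {σ} {τ} (proj₁ (to T-∧ h))))) _)
        (λ h → let a = does⇒ (agree? ⁅ v ⁆ σ τ) h in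
          from T-∧ (agreeOff⁺ a , any⁺ _ (lose
            (∈-available⁺ σ v (proj₁ (∈Ω⁻ τ∈) v) (free-cong a (free-at v τ∈))) (ℕₚ.≡⇒≡ᵇ (lookup τ v) _ refl))))
      value : (if does (agree? ⁅ v ⁆ σ τ) then inv n * inv (length (available G L σ v)) else 0ℚ) ≡ inv n * ker ⁅ v ⁆ σ τ
      value with does (agree? ⁅ v ⁆ σ τ)
      ... | true  = cong (λ z → inv n * inv z) (≡-sym (length-class-singleton v σ∈))
      ... | false = ≡-sym (*-zeroʳ (inv n))

    -- The merge of τ on A with σ elsewhere is an intermediate state: it is reached
    -- from σ inside A and reaches τ inside B.
    ker-split : ∀ {S A B} → A ⊆ S → B ⊆ S → (∀ {u} → u ∈ S → u ∈ A ⊎ u ∈ B) →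
                (∀ {u} → u ∈ A → u ∉ B) → (∀ {u w} → u ∈ A → w ∈ B → ¬ Adjacent G u w) →
                ∀ {σ τ} → σ ∈ₗ Ω G L → τ ∈ₗ Ω G L → ker S σ τ ≤ 1ℚ * (ker A ⊙ ker B) σ τ
    ker-split {S} {A} {B} A⊆S B⊆S cover disj apart {σ} {τ} σ∈ τ∈ with agree? S σ τ
    ... | no ¬h = ≤-trans (≤-reflexive (kernel-no S ¬h))
                          (0≤* 0≤1 (nonneg (⊙-doublyStochastic (ker-doubly A) (ker-doubly B)) σ τ))
    ... | yes h = begin
      ker S σ τ
        ≡⟨ kernel-yes S h ⟩
      inv (length (class S σ))
        ≤⟨ inv-anti {{ℕₚ.m*n≢0 _ _ {{class-nonempty A σ∈}} {{class-nonempty B ρ∈}}}} count ⟩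
      inv (length (class A σ) ℕ.* length (class B ρ))
        ≡⟨ inv-* _ _ {{class-nonempty A σ∈}} {{class-nonempty B ρ∈}} ⟩
      inv (length (class A σ)) * inv (length (class B ρ))
        ≡⟨ cong₂ _*_ (≡-sym (kernel-yes A σ~ρ)) (≡-sym (kernel-yes B ρ~τ)) ⟩
      ker A σ ρ * ker B ρ τ
        ≤⟨ term≤Σ (Ω G L) (λ κ → 0≤* (0≤kernel A σ κ) (0≤kernel B κ τ)) ρ∈ ⟩
      (ker A ⊙ ker B) σ τ
        ≡⟨ ≡-sym (*-identityˡ ((ker A ⊙ ker B) σ τ)) ⟩
      1ℚ * (ker A ⊙ ker B) σ τ ∎
      where
      open ≤-Reasoning
      ρ : Colouring n
      ρ = merge A τ σ
      ρ∈ : ρ ∈ₗ Ω G L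
      ρ∈ = merge-valid τ∈ σ∈ λ {u} {w} u∈ w∉ e →
        ≡-sym (off h w λ w∈S → [ w∉ , (λ w∈B → apart u∈ w∈B e) ]′ (cover w∈S))
      σ~ρ : Agree A σ ρ
      σ~ρ = agree λ u u∉ → ≡-sym (merge-out τ σ u∉)
      ρ~τ : Agree B ρ τ
      off ρ~τ u u∉ with u ∈? A
      ... | yes u∈A = merge-in τ σ u∈A
      ... | no  u∉A = trans (merge-out τ σ u∉A) (off h u λ u∈S → [ u∉A , u∉ ]′ (cover u∈S))
      count : length (class A σ) ℕ.* length (class B ρ) ℕ.≤ length (class S σ)
      count = ℕₚ.≤-trans (ℕₚ.≤-reflexive (≡-sym (length-cartesianProductWith _,_ (class A σ) (class B ρ))))
        (unique-covered⇒length≤ (λ κ → merge A κ σ , merge B κ ρ)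
          (Uniq.cartesianProduct⁺ (class-unique A σ) (class-unique B ρ)) covered)
        where
        covered : ∀ {p} → p ∈ₗ cartesianProduct (class A σ) (class B ρ) →
                  ∃[ κ ] (κ ∈ₗ class S σ × p ≡ (merge A κ σ , merge B κ ρ))
        covered {α , β} p∈ with ∈-cartesianProduct⁻ (class A σ) (class B ρ) p∈
        ... | α∈ , β∈ with ∈class⁻ A σ α∈ | ∈class⁻ B ρ β∈
        ...   | α∈Ω , α~ | β∈Ω , β~ = κ , ∈class⁺ S σ κ∈ κ~ , cong₂ _,_ (lookup-ext eqα) (lookup-ext eqβ)
          where
          -- Glues `β` on `B` to `α` elsewhere. At an edge leaving `B` the outer end lies outside
          -- `A` by `apart`, so both colourings have the colour of `σ` there.
          κ : Colouring n
          κ = merge B β α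
          κ∈ : κ ∈ₗ Ω G L
          κ∈ = merge-valid β∈Ω α∈Ω λ {u} {w} u∈ w∉ e →
            let w∉A = λ w∈A → apart w∈A u∈ (adj-sym e) in
            trans (≡-sym (off β~ w w∉)) (trans (merge-out τ σ w∉A) (off α~ w w∉A))
          κ~ : Agree S σ κ
          κ~ = agree λ u u∉ → trans (off α~ u (u∉ ∘ A⊆S)) (≡-sym (merge-out β α (u∉ ∘ B⊆S)))
          eqα : ∀ u → lookup α u ≡ lookup (merge A κ σ) u
          eqα u with u ∈? A
          ... | yes u∈ = ≡-sym (trans (merge-in κ σ u∈) (merge-out β α (disj u∈)))
          ... | no  u∉ = trans (≡-sym (off α~ u u∉)) (≡-sym (merge-out κ σ u∉))
          eqβ : ∀ u → lookup β u ≡ lookup (merge B κ ρ) u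
          eqβ u with u ∈? B
          ... | yes u∈ = ≡-sym (trans (merge-in κ ρ u∈) (merge-in β α u∈))
          ... | no  u∉ = trans (≡-sym (off β~ u u∉)) (≡-sym (merge-out κ ρ u∉))

    -- One filter per neighbour, because each of them costs at most a factor of two.
    avoiding : Subset n → Colouring n → ℕ → List (Fin n) → List (Colouring n)
    avoiding S σ c []       = class S σ
    avoiding S σ c (u ∷ us) = filter (λ ρ → ¬? (lookup ρ u ℕ.≟ c)) (avoiding S σ c us)

    avoiding⁻ : ∀ S σ c us {ρ} → ρ ∈ₗ avoiding S σ c us → ρ ∈ₗ class S σ × (∀ {u} → u ∈ₗ us → lookup ρ u ≢ c)
    avoiding⁻ S σ c []       ρ∈ = ρ∈ , λ ()
    avoiding⁻ S σ c (u ∷ us) ρ∈ with ∈-filter⁻ _ {xs = avoiding S σ c us} ρ∈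
    ... | ρ∈′ , ne with avoiding⁻ S σ c us ρ∈′
    ...   | ρ∈c , all≢ = ρ∈c , λ { (here refl) → ne ; (there k) → all≢ k }

    avoiding⁺ : ∀ S σ c us {ρ} → ρ ∈ₗ class S σ → (∀ {u} → u ∈ₗ us → lookup ρ u ≢ c) → ρ ∈ₗ avoiding S σ c us
    avoiding⁺ S σ c []       ρ∈ h = ρ∈
    avoiding⁺ S σ c (u ∷ us) ρ∈ h = ∈-filter⁺ _ (avoiding⁺ S σ c us ρ∈ (h ∘ there)) (h (here refl))

    avoiding-unique : ∀ S σ c us → Unique (avoiding S σ c us)
    avoiding-unique S σ c []       = class-unique S σ
    avoiding-unique S σ c (u ∷ us) = Uniq.filter⁺ _ (avoiding-unique S σ c us)

    -- A vertex u ∈ S coloured c has another available colour, and recolouring it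
    -- is undone by giving it colour c again.
    avoiding-halves : ∀ S σ c us → (∀ {u} → u ∈ₗ us → u ∉ S → lookup σ u ≢ c) →
                      length (class S σ) ℕ.≤ 2 ℕ.^ length us ℕ.* length (avoiding S σ c us)
    avoiding-halves S σ c []       h = ℕₚ.≤-reflexive (≡-sym (ℕₚ.+-identityʳ _))
    avoiding-halves S σ c (u ∷ us) h = begin
      length (class S σ)                              ≤⟨ avoiding-halves S σ c us (h ∘ there) ⟩
      2 ℕ.^ length us ℕ.* length (avoiding S σ c us)  ≤⟨ ℕₚ.*-monoʳ-≤ (2 ℕ.^ length us) half ⟩
      2 ℕ.^ length us ℕ.* (2 ℕ.* length (avoiding S σ c (u ∷ us)))
        ≡⟨ trans (≡-sym (ℕₚ.*-assoc (2 ℕ.^ length us) 2 _)) (cong (ℕ._* length (avoiding S σ c (u ∷ us))) (ℕₚ.*-comm (2 ℕ.^ length us) 2)) ⟩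
      2 ℕ.^ length (u ∷ us) ℕ.* length (avoiding S σ c (u ∷ us)) ∎
      where
      open ℕₚ.≤-Reasoning
      undo : ∀ {ρ} → ρ ∈ₗ filter (λ ρ → ¬? (¬? (lookup ρ u ℕ.≟ c))) (avoiding S σ c us) →
             ∃[ κ ] (κ ∈ₗ avoiding S σ c (u ∷ us) × ρ ≡ κ [ u ]≔ c)
      undo {ρ} ρ∈ with ∈-filter⁻ _ {xs = avoiding S σ c us} ρ∈
      ... | ρ∈′ , ¬¬eq with lookup ρ u ℕ.≟ c | avoiding⁻ S σ c us ρ∈′
      ...   | no ne  | _ = ⊥-elim (¬¬eq ne)
      ...   | yes eq | ρ∈c , all≢ with ∈class⁻ S σ ρ∈c | other-colour ρ u c (deg+2≤L u) | u ∈? S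
      -- Off `S` the colour at `u` is that of `σ`, which the hypothesis keeps away from `c`.
      ...     | _   , ρ~ | _ | no u∉ = ⊥-elim (h (here refl) u∉ (trans (off ρ~ u u∉) eq))
      ...     | ρ∈Ω , ρ~ | c′ , c′∈ , c′≢c | yes u∈ = κ , κ∈ , lookup-ext back
        where
        κ : Colouring n
        κ = ρ [ u ]≔ c′
        κ≢ : ∀ {w} → w ∈ₗ (u ∷ us) → lookup κ w ≢ c
        κ≢ {w} w∈ with w ≟ᶠ u | w∈
        ... | yes refl | _ rewrite lookup∘update w ρ c′ = c′≢c
        ... | no  w≢u  | here w≡u = ⊥-elim (w≢u w≡u)
        ... | no  w≢u  | there k rewrite lookup∘update′ w≢u ρ c′ = all≢ k
        κ∈ : κ ∈ₗ avoiding S σ c (u ∷ us)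
        κ∈ = let (c′∈L , fr) = ∈-available⁻ ρ u c′∈ in
          avoiding⁺ S σ c (u ∷ us) (∈class⁺ S σ (recolour ρ∈Ω c′∈L fr) (agree-trans ρ~ (agree-sym (agree-update ρ c′ u∈)))) κ≢
        back : ∀ w → lookup ρ w ≡ lookup (κ [ u ]≔ c) w
        back w with w ≟ᶠ u
        ... | yes refl = trans eq (≡-sym (lookup∘update w κ c))
        ... | no  w≢u  = ≡-sym (trans (lookup∘update′ w≢u κ c) (lookup∘update′ w≢u ρ c′))
      half : length (avoiding S σ c us) ℕ.≤ 2 ℕ.* length (avoiding S σ c (u ∷ us))
      half = begin
        length (avoiding S σ c us)
          ≡⟨ length-filter-split (λ ρ → ¬? (lookup ρ u ℕ.≟ c)) (avoiding S σ c us) ⟩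
        length (avoiding S σ c (u ∷ us)) ℕ.+ length (filter (λ ρ → ¬? (¬? (lookup ρ u ℕ.≟ c))) (avoiding S σ c us))
          ≤⟨ ℕₚ.+-monoʳ-≤ (length (avoiding S σ c (u ∷ us)))
               (unique-covered⇒length≤ (_[ u ]≔ c) (Uniq.filter⁺ _ (avoiding-unique S σ c us)) undo) ⟩
        length (avoiding S σ c (u ∷ us)) ℕ.+ length (avoiding S σ c (u ∷ us))
          ≡⟨ cong (length (avoiding S σ c (u ∷ us)) ℕ.+_) (≡-sym (ℕₚ.+-identityʳ _)) ⟩
        2 ℕ.* length (avoiding S σ c (u ∷ us)) ∎

    Σ-avoiding≤ : ∀ S σ c us {f} → (∀ ρ → 0ℚ ≤ f ρ) → Σℚ (avoiding S σ c us) f ≤ Σℚ (Ω G L) f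
    Σ-avoiding≤ S σ c []       h = Σ-filter≤ (agree? S σ) (Ω G L) h
    Σ-avoiding≤ S σ c (u ∷ us) h = ≤-trans (Σ-filter≤ _ (avoiding S σ c us) h) (Σ-avoiding≤ S σ c us h)

    C₁ : ℕ
    C₁ = q ℕ.* 2 ℕ.^ Δ

    -- `B` holds the intermediate states ρ. The sizes `a` and `b` of the classes of `σ` and `τ` for
    -- `S′` may differ, as the two may disagree at `x`; the first resampling pays `inv a`, the
    -- second `inv b`.
    module VertexStep {S : Subset n} {x : Fin n} (x∈S : x ∈ S) {σ τ : Colouring n}
                      (σ∈ : σ ∈ₗ Ω G L) (τ∈ : τ ∈ₗ Ω G L) (σ~τ : Agree S σ τ) where

      private
        S′ : Subset n
        S′ = S Sub.- x
        c : ℕ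
        c = lookup τ x
        us : List (Fin n)
        us = filterᵇ (adj G x) (allFin n)
        B : List (Colouring n)
        B = avoiding S′ σ c us
        a b s β : ℕ
        a = length (class S′ σ)
        b = length (class S′ τ)
        s = length (class S σ)
        β = length B

        S′⊆S : S′ ⊆ S
        S′⊆S = p─q⊆p S ⁅ x ⁆

        us⇒adj : ∀ {u} → u ∈ₗ us → Adjacent G x u
        us⇒adj u∈ = proj₂ (∈-filter⁻ (T? ∘ adj G x) {xs = allFin n} u∈)

        -- A neighbour of `x` outside `S′` is outside `S`, where `σ` and `τ` agree, and proper `τ`
        -- does not use its colour at `x` next to `x`.
        outside-ok : ∀ {u} → u ∈ₗ us → u ∉ S′ → lookup σ u ≢ c
        outside-ok {u} u∈ u∉ eq = proj₂ (∈Ω⁻ τ∈) x u (us⇒adj u∈) (≡-sym (trans (≡-sym (off σ~τ u u∉S)) eq))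
          where
          u≢x : u ≢ x
          u≢x refl = adj-irrefl (us⇒adj u∈)
          u∉S : u ∉ S
          u∉S u∈S = u∉ (x∈p∧x≢y⇒x∈p-y u∈S u≢x)

        a≤ : a ℕ.≤ 2 ℕ.^ Δ ℕ.* β
        a≤ = ℕₚ.≤-trans (avoiding-halves S′ σ c us outside-ok) (ℕₚ.*-monoˡ-≤ β (ℕₚ.^-monoʳ-≤ 2 (deg≤Δ x)))

        -- The second resampling stays in the class of `τ` for `S`, which is that of `σ`.
        b≤s : b ℕ.≤ s
        b≤s = ℕₚ.≤-trans (unique⊆⇒length≤ (class-unique S′ τ) λ ρ∈ →
                let (ρ∈Ω , h) = ∈class⁻ S′ τ ρ∈ in ∈class⁺ S τ ρ∈Ω (agree-mono S′⊆S h))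
              (ℕₚ.≤-reflexive (cong length (≡-sym (class-cong S σ~τ))))

        through : ∀ {ρ} → ρ ∈ₗ B → inv a * (inv q * inv b) ≤ ker S′ σ ρ * (ker ⁅ x ⁆ ⊙ ker S′) ρ τ
        through {ρ} ρ∈B with avoiding⁻ S′ σ c us ρ∈B
        ... | ρ∈c , ρ≢c with ∈class⁻ S′ σ ρ∈c
        ...   | ρ∈ , σ~ρ = *-mono (0≤inv a) (nonneg (⊙-doublyStochastic (ker-doubly ⁅ x ⁆) (ker-doubly S′)) ρ τ)
                  (≤-reflexive (≡-sym (kernel-yes S′ σ~ρ)))
                  (≤-trans (*-mono (0≤inv q) (0≤kernel S′ φ τ)
                     (≤-trans (inv-anti {{class-nonempty ⁅ x ⁆ ρ∈}} (length-class-singleton≤q x ρ∈))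
                              (≤-reflexive (≡-sym (kernel-yes ⁅ x ⁆ (agree-at ρ x c)))))
                     (≤-reflexive (≡-sym (trans (kernel-yes S′ φ~τ) (cong (inv ∘ length) (class-cong S′ φ~τ))))))
                    (term≤Σ (Ω G L) (λ κ → 0≤* (0≤kernel ⁅ x ⁆ ρ κ) (0≤kernel S′ κ τ)) φ∈))
          where
          φ : Colouring n
          φ = ρ [ x ]≔ c
          φ∈ : φ ∈ₗ Ω G L
          φ∈ = recolour ρ∈ (proj₁ (∈Ω⁻ τ∈) x)
                 (mkFree λ u e → ρ≢c (∈-filter⁺ (T? ∘ adj G x) (∈-allFin u) e))
          φ~τ : Agree S′ φ τ
          off φ~τ u u∉ with u ≟ᶠ x
          ... | yes refl = lookup∘update u ρ c
          ... | no  u≢x  = trans (lookup∘update′ u≢x ρ c) (trans (≡-sym (off σ~ρ u u∉))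
                             (off σ~τ u (λ u∈S → u∉ (x∈p∧x≢y⇒x∈p-y u∈S u≢x))))

        instance
          q≢0 : ℕ.NonZero q
          q≢0 = ℕ.>-nonZero (ℕₚ.<-≤-trans (ℕ.>-nonZero⁻¹ _ {{class-nonempty ⁅ x ⁆ σ∈}}) (length-class-singleton≤q x σ∈))
          a≢0 : ℕ.NonZero a
          a≢0 = class-nonempty S′ σ∈

      -- There are `β` routes, each of weight at least `inv a * (inv q * inv b)`. Since `a` is at
      -- most 2^Δ `β`, their sum times `C₁` is at least `inv b`, hence at least `inv s`.
      bound : inv s ≤ ι C₁ * (ker S′ ⊙ (ker ⁅ x ⁆ ⊙ ker S′)) σ τ
      bound = begin
        inv s
          ≤⟨ inv-anti {{class-nonempty S′ τ∈}} b≤s ⟩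
        inv b
          ≡⟨ ≡-sym (trans (cong₂ (λ y z → y * (z * inv b)) (trans (*-comm (ι q) (inv q)) (inv-ι q)) (trans (*-comm (ι a) (inv a)) (inv-ι a)))
               (trans (*-identityˡ (1ℚ * inv b)) (*-identityˡ (inv b)))) ⟩
        (ι q * inv q) * ((ι a * inv a) * inv b)
          ≤⟨ *-monoˡ (0≤* (0≤ι q) (0≤inv q)) (*-monoʳ (0≤inv b) (*-monoʳ (0≤inv a)
               (≤-trans (ι-mono a≤) (≤-reflexive (ι-* (2 ℕ.^ Δ) β))))) ⟩
        (ι q * inv q) * (((ι (2 ℕ.^ Δ) * ι β) * inv a) * inv b)
          ≡⟨ solve 6 (λ q r p β a b → (q :* r) :* (((p :* β) :* a) :* b) := (q :* p) :* (β :* (a :* (r :* b)))) refl (ι q) (inv q) (ι (2 ℕ.^ Δ)) (ι β) (inv a) (inv b) ⟩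
        (ι q * ι (2 ℕ.^ Δ)) * (ι β * (inv a * (inv q * inv b)))
          ≡⟨ cong₂ _*_ (≡-sym (ι-* q (2 ℕ.^ Δ))) (≡-sym (Σ-const B (inv a * (inv q * inv b)))) ⟩
        ι C₁ * Σℚ B (λ _ → inv a * (inv q * inv b))
          ≤⟨ *-monoˡ (0≤ι C₁) (≤-trans (Σ-mono B through)
               (Σ-avoiding≤ S′ σ c us λ ρ → 0≤* (0≤kernel S′ σ ρ) (nonneg (⊙-doublyStochastic (ker-doubly ⁅ x ⁆) (ker-doubly S′)) ρ τ))) ⟩
        ι C₁ * (ker S′ ⊙ (ker ⁅ x ⁆ ⊙ ker S′)) σ τ ∎
        where open ≤-Reasoning

    ker-vertex : ∀ {S x} → x ∈ S → ∀ {σ τ} → σ ∈ₗ Ω G L → τ ∈ₗ Ω G L →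
                 ker S σ τ ≤ ι C₁ * (ker (S Sub.- x) ⊙ (ker ⁅ x ⁆ ⊙ ker (S Sub.- x))) σ τ
    ker-vertex {S} {x} x∈S {σ} {τ} σ∈ τ∈ with agree? S σ τ
    ... | no ¬h = ≤-trans (≤-reflexive (kernel-no S ¬h)) (0≤* (0≤ι C₁)
            (nonneg (⊙-doublyStochastic (ker-doubly _) (⊙-doublyStochastic (ker-doubly _) (ker-doubly _))) σ τ))
    ... | yes h = ≤-trans (≤-reflexive (kernel-yes S h)) (VertexStep.bound x∈S σ∈ τ∈ h)

    -- Comparison with the single-site energies

    localEnergy : (Colouring n → ℚ) → ℚ
    localEnergy f = Σℚ (allFin n) λ v → energy (ker ⁅ v ⁆) f

    0≤localEnergy : ∀ f → 0ℚ ≤ localEnergy f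
    0≤localEnergy f = Σ-nonneg (allFin n) λ v → 0≤energy (0≤kernel ⁅ v ⁆) f

    -- The right-hand side is the energy of all vertices, whatever `S` is, so bounds for different
    -- sets combine without tracking which vertices they involve.
    record Bounded (S : Subset n) (K : ℕ) : Set where
      constructor bounded
      field bound : ∀ f → energy (ker S) f ≤ ι K * localEnergy f
    open Bounded public

    -- The energy vanishes; the constant 1 is the zeroth power in `poincare` and keeps the constants
    -- positive, as `bounded-vertex` requires.
    bounded-empty : ∀ {S} → (∀ u → u ∉ S) → Bounded S 1
    bounded-empty {S} none = bounded λ f → ≤-trans (≤-reflexive (zero-energy f)) (0≤* (0≤ι 1) (0≤localEnergy f))
      where
      zero-term : ∀ f σ τ → ker S σ τ * sq (f σ - f τ) ≡ 0ℚ
      zero-term f σ τ with agree? S σ τ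
      ... | no ¬h = trans (cong (_* sq (f σ - f τ)) (kernel-no S ¬h)) (*-zeroˡ (sq (f σ - f τ)))
      ... | yes h with lookup-ext {σ = σ} {τ} (λ u → off h u (none u))
      ...   | refl = trans (cong (λ z → ker S σ σ * sq z) (+-inverseʳ (f σ)))
                       (trans (cong (ker S σ σ *_) (*-zeroˡ 0ℚ)) (*-zeroʳ (ker S σ σ)))
      zero-energy : ∀ f → energy (ker S) f ≡ 0ℚ
      zero-energy f = trans (Σ-cong (Ω G L) λ {σ} _ →
        trans (Σ-cong (Ω G L) λ {τ} _ → zero-term f σ τ) (Σ-zero (Ω G L))) (Σ-zero (Ω G L))

    bounded-split : ∀ {S A B K} → A ⊆ S → B ⊆ S → (∀ {u} → u ∈ S → u ∈ A ⊎ u ∈ B) →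
                    (∀ {u} → u ∈ A → u ∉ B) → (∀ {u w} → u ∈ A → w ∈ B → ¬ Adjacent G u w) →
                    Bounded A K → Bounded B K → Bounded S (4 ℕ.* K)
    bounded-split {S} {A} {B} {K} A⊆S B⊆S cover disj apart bA bB = bounded λ f → begin
      energy (ker S) f
        ≤⟨ energy-mono {ker S} {ker A ⊙ ker B} {1ℚ} (ker-split A⊆S B⊆S cover disj apart) f ⟩
      1ℚ * energy (ker A ⊙ ker B) f
        ≤⟨ *-monoˡ 0≤1 (≤-trans (energy-⊙ (ker-doubly A) (ker-doubly B) f)
             (+-mono-≤ (*-monoˡ 0≤2 (bound bA f)) (*-monoˡ 0≤2 (bound bB f)))) ⟩
      1ℚ * (2ℚ * (ι K * localEnergy f) + 2ℚ * (ι K * localEnergy f))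
        ≡⟨ solve 2 (λ k d → con 1ℚ :* (con 2ℚ :* (k :* d) :+ con 2ℚ :* (k :* d)) := (con (ι 4) :* k) :* d) refl (ι K) (localEnergy f) ⟩
      (ι 4 * ι K) * localEnergy f
        ≡⟨ cong (_* localEnergy f) (≡-sym (ι-* 4 K)) ⟩
      ι (4 ℕ.* K) * localEnergy f ∎
      where open ≤-Reasoning

    -- 10 = 2 + 2 (2 + 2), from two nested uses of `energy-⊙`. The hypothesis `1 ≤ K` lets the
    -- energy at `x` be absorbed into the same constant.
    bounded-vertex : ∀ {S x K} → x ∈ S → 1 ℕ.≤ K → Bounded (S Sub.- x) K → Bounded S (10 ℕ.* C₁ ℕ.* K)
    bounded-vertex {S} {x} {K} x∈S 1≤K b = bounded λ f → begin
      energy (ker S) f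
        ≤⟨ energy-mono {ker S} {ker S′ ⊙ (ker ⁅ x ⁆ ⊙ ker S′)} {ι C₁} (ker-vertex x∈S) f ⟩
      ι C₁ * energy (ker S′ ⊙ (ker ⁅ x ⁆ ⊙ ker S′)) f
        ≤⟨ *-monoˡ (0≤ι C₁) (≤-trans (energy-⊙ (ker-doubly S′) (⊙-doublyStochastic (ker-doubly ⁅ x ⁆) (ker-doubly S′)) f)
             (+-mono-≤ (*-monoˡ 0≤2 (bound b f))
               (*-monoˡ 0≤2 (≤-trans (energy-⊙ (ker-doubly ⁅ x ⁆) (ker-doubly S′) f)
                 (+-mono-≤ (*-monoˡ 0≤2 (single f)) (*-monoˡ 0≤2 (bound b f))))))) ⟩
      ι C₁ * (2ℚ * (ι K * localEnergy f) + 2ℚ * (2ℚ * (ι K * localEnergy f) + 2ℚ * (ι K * localEnergy f)))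
        ≡⟨ solve 3 (λ c k d → c :* (con 2ℚ :* (k :* d) :+ con 2ℚ :* (con 2ℚ :* (k :* d) :+ con 2ℚ :* (k :* d))) := ((con (ι 10) :* c) :* k) :* d) refl (ι C₁) (ι K) (localEnergy f) ⟩
      ((ι 10 * ι C₁) * ι K) * localEnergy f
        ≡⟨ cong (_* localEnergy f) (≡-sym (trans (ι-* (10 ℕ.* C₁) K) (cong (_* ι K) (ι-* 10 C₁)))) ⟩
      ι (10 ℕ.* C₁ ℕ.* K) * localEnergy f ∎
      where
      open ≤-Reasoning
      S′ : Subset n
      S′ = S Sub.- x
      single : ∀ f → energy (ker ⁅ x ⁆) f ≤ ι K * localEnergy f
      single f = begin
        energy (ker ⁅ x ⁆) f   ≤⟨ term≤Σ (allFin n) (λ v → 0≤energy (0≤kernel ⁅ v ⁆) f) (∈-allFin x) ⟩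
        localEnergy f          ≡⟨ ≡-sym (*-identityˡ (localEnergy f)) ⟩
        1ℚ * localEnergy f     ≤⟨ *-monoʳ (0≤localEnergy f) (ι-mono 1≤K) ⟩
        ι K * localEnergy f    ∎

    bounded-mono : ∀ {S K K′} → K ℕ.≤ K′ → Bounded S K → Bounded S K′
    bounded-mono h b = bounded λ f → ≤-trans (bound b f) (*-monoʳ (0≤localEnergy f) (ι-mono h))

    C₂ : ℕ
    C₂ = 10 ℕ.* C₁

    module _ (1≤q : 1 ℕ.≤ q) where

      private
        1≤C₂^ : ∀ r → 1 ℕ.≤ C₂ ℕ.^ r
        1≤C₂^ r = ℕ.>-nonZero⁻¹ _ {{ℕₚ.m^n≢0 C₂ r {{ℕₚ.m*n≢0 10 C₁ {{_}} {{ℕₚ.m*n≢0 q (2 ℕ.^ Δ) {{ℕ.>-nonZero 1≤q}} {{ℕₚ.m^n≢0 2 Δ}}}}}}}}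

      bounded-separated : ∀ {w S K} → 1 ℕ.≤ K → (sep : Separator G w S) →
        (∀ {S′} → 3 ℕ.* ∣ S′ ∣ ℕ.≤ 2 ℕ.* ∣ S ∣ → Bounded S′ K) →
        ∀ r {R} → R ⊆ S → ∣ R ∩ Separator.X sep ∣ ℕ.≤ r → Bounded R (C₂ ℕ.^ r ℕ.* (4 ℕ.* K))
      bounded-separated {w} {S} {K} 1≤K sep small r {R} R⊆S h with nonempty? (R ∩ X)
        where open Separator sep
      ... | no none = bounded-mono (ℕₚ.≤-trans (ℕₚ.≤-reflexive (≡-sym (ℕₚ.*-identityˡ _))) (ℕₚ.*-monoˡ-≤ (4 ℕ.* K) (1≤C₂^ r)))
          (bounded-split (λ k → proj₁ (x∈p∩q⁻ R A k)) (p─q⊆p R A) cover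
            (λ u∈ u∈′ → x∈p─q⇒x∉q R A u∈′ (proj₂ (x∈p∩q⁻ R A u∈))) apart
            (small (ℕₚ.≤-trans (ℕₚ.*-monoʳ-≤ 3 (p⊆q⇒∣p∣≤∣q∣ inner⊆)) inner))
            (small (ℕₚ.≤-trans (ℕₚ.*-monoʳ-≤ 3 (p⊆q⇒∣p∣≤∣q∣ outer⊆)) outer)))
        where
        open Separator sep
        cover : ∀ {u} → u ∈ R → u ∈ R ∩ A ⊎ u ∈ R ─ A
        cover {u} u∈ with u ∈? A
        ... | yes k = inj₁ (x∈p∩q⁺ (u∈ , k))
        ... | no ¬k = inj₂ (x∈p∧x∉q⇒x∈p─q u∈ ¬k)
        apart : ∀ {u v} → u ∈ R ∩ A → v ∈ R ─ A → ¬ Adjacent G u v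
        apart {u} {v} u∈ v∈ e with x∈p∪q⁻ A X (closed (proj₂ (x∈p∩q⁻ R A u∈)) e)
        ... | inj₁ v∈A = x∈p─q⇒x∉q R A v∈ v∈A
        ... | inj₂ v∈X = none (v , x∈p∩q⁺ (p─q⊆p R A v∈ , v∈X))
        inner⊆ : R ∩ A ⊆ S ∩ A
        inner⊆ k with x∈p∩q⁻ R A k
        ... | k₁ , k₂ = x∈p∩q⁺ (R⊆S k₁ , k₂)
        outer⊆ : R ─ A ⊆ S ─ (A ∪ X)
        outer⊆ {u} k = x∈p∧x∉q⇒x∈p─q (R⊆S (p─q⊆p R A k)) λ m →
          [ x∈p─q⇒x∉q R A k , (λ u∈X → none (u , x∈p∩q⁺ (p─q⊆p R A k , u∈X))) ]′ (x∈p∪q⁻ A X m)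
      bounded-separated {w} {S} {K} 1≤K sep small r {R} R⊆S h | yes (x , x∈) with r
      ... | zero  = ⊥-elim (ℕₚ.n≮0 (ℕₚ.≤-trans (ℕₚ.≤-trans (s≤s z≤n) (x∈p⇒∣p-x∣<∣p∣ x∈)) h))
      ... | suc r = bounded-mono (ℕₚ.≤-reflexive (≡-sym (ℕₚ.*-assoc C₂ (C₂ ℕ.^ r) (4 ℕ.* K))))
          (bounded-vertex {K = C₂ ℕ.^ r ℕ.* (4 ℕ.* K)} x∈R
            (ℕₚ.*-mono-≤ (1≤C₂^ r) (ℕₚ.≤-trans 1≤K (ℕₚ.m≤m+n K _)))
            (bounded-separated 1≤K sep small r (R⊆S ∘ p─q⊆p R ⁅ x ⁆) (ℕₚ.≤-pred (ℕₚ.≤-trans fewer h))))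
        where
        open Separator sep
        x∈R : x ∈ R
        x∈R = proj₁ (x∈p∩q⁻ R X x∈)
        fewer : ∣ (R Sub.- x) ∩ X ∣ ℕ.< ∣ R ∩ X ∣
        fewer = p⊂q⇒∣p∣<∣q∣ (sub , x , x∈ , λ k → x∈p─q⇒x∉q R ⁅ x ⁆ (proj₁ (x∈p∩q⁻ (R Sub.- x) X k)) (x∈⁅x⁆ x))
          where
          sub : (R Sub.- x) ∩ X ⊆ R ∩ X
          sub k with x∈p∩q⁻ (R Sub.- x) X k
          ... | k₁ , k₂ = x∈p∩q⁺ (p─q⊆p R ⁅ x ⁆ k₁ , k₂)

      -- Induction on the number of levels: the size condition is |S| (2/3)^ℓ < 1 cleared of
      -- denominators, which passes to parts of two thirds the size and forces `S` to be empty at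
      -- level 0.
      poincare : ∀ {w} → (∀ S → Separator G w S) → ∀ ℓ S → ∣ S ∣ ℕ.* 2 ℕ.^ ℓ ℕ.< 3 ℕ.^ ℓ →
                 Bounded S ((C₂ ℕ.^ suc w ℕ.* 4) ℕ.^ ℓ)
      poincare sep zero S h = bounded-empty λ u u∈ →
        ℕₚ.<⇒≱ h (ℕₚ.≤-trans (ℕₚ.≤-trans (s≤s z≤n) (x∈p⇒∣p-x∣<∣p∣ u∈)) (ℕₚ.≤-reflexive (≡-sym (ℕₚ.*-identityʳ ∣ S ∣))))
      poincare {w} sep (suc ℓ) S h =
        bounded-mono (ℕₚ.≤-reflexive (≡-sym (ℕₚ.*-assoc (C₂ ℕ.^ suc w) 4 K)))
          (bounded-separated 1≤K (sep S) rec (suc w) id (ℕₚ.≤-trans (∣p∩q∣≤∣q∣ S (X (sep S))) (size (sep S))))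
        where
        open Separator using (X; size)
        K : ℕ
        K = (C₂ ℕ.^ suc w ℕ.* 4) ℕ.^ ℓ
        1≤K : 1 ℕ.≤ K
        1≤K = ℕ.>-nonZero⁻¹ _ {{ℕₚ.m^n≢0 (C₂ ℕ.^ suc w ℕ.* 4) ℓ {{ℕₚ.m*n≢0 (C₂ ℕ.^ suc w) 4 {{ℕ.>-nonZero (1≤C₂^ (suc w))}}}}}}
        rec : ∀ {S′} → 3 ℕ.* ∣ S′ ∣ ℕ.≤ 2 ℕ.* ∣ S ∣ → Bounded S′ K
        rec {S′} k = poincare sep ℓ S′ (ℕₚ.*-cancelˡ-< 3 (∣ S′ ∣ ℕ.* 2 ℕ.^ ℓ) (3 ℕ.^ ℓ) (begin-strict
          3 ℕ.* (∣ S′ ∣ ℕ.* 2 ℕ.^ ℓ)   ≡⟨ ≡-sym (ℕₚ.*-assoc 3 ∣ S′ ∣ (2 ℕ.^ ℓ)) ⟩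
          3 ℕ.* ∣ S′ ∣ ℕ.* 2 ℕ.^ ℓ     ≤⟨ ℕₚ.*-monoˡ-≤ (2 ℕ.^ ℓ) k ⟩
          2 ℕ.* ∣ S ∣ ℕ.* 2 ℕ.^ ℓ      ≡⟨ trans (cong (ℕ._* 2 ℕ.^ ℓ) (ℕₚ.*-comm 2 ∣ S ∣)) (ℕₚ.*-assoc ∣ S ∣ 2 (2 ℕ.^ ℓ)) ⟩
          ∣ S ∣ ℕ.* 2 ℕ.^ suc ℓ        <⟨ h ⟩
          3 ℕ.^ suc ℓ                  ∎))
          where open ℕₚ.≤-Reasoning

    -- From the spectral gap to total variation

    module Mixing {{_ : ℕ.NonZero n}} where

      private
        Σ-inv-n : Σℚ (allFin n) (λ _ → inv n) ≡ 1ℚ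
        Σ-inv-n = trans (Σ-const (allFin n) (inv n))
          (trans (cong (λ z → ι z * inv n) (length-tabulate {n = n} id)) (trans (*-comm (ι n) (inv n)) (inv-ι n)))

      open Average (allFin n) (inv n) (0≤inv n) Σ-inv-n (λ v → ker ⁅ v ⁆) (λ v → kernel-projection ⁅ v ⁆)

      module _ {K : ℕ} {{_ : ℕ.NonZero K}} (gap : Bounded Sub.⊤ K) {σ₀ : Colouring n} (σ₀∈ : σ₀ ∈ₗ Ω G L) where

        private
          N : ℕ
          N = length (Ω G L)

          instance
            N≢0 : ℕ.NonZero N
            N≢0 = nonempty σ₀∈
              where
              nonempty : ∀ {xs : List (Colouring n)} {x} → x ∈ₗ xs → ℕ.NonZero (length xs)
              nonempty {_ ∷ _} _ = _
            n*K≢0 : ℕ.NonZero (n ℕ.* K)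
            n*K≢0 = ℕₚ.m*n≢0 n K

          f : ℕ → Colouring n → ℚ
          f s τ = dist G L σ₀ s τ - inv N

          Σ-inv-N : Σℚ (Ω G L) (λ _ → inv N) ≡ 1ℚ
          Σ-inv-N = trans (Σ-const (Ω G L) (inv N)) (trans (*-comm (ι N) (inv N)) (inv-ι N))

          P≡average : ∀ {σ τ} → σ ∈ₗ Ω G L → τ ∈ₗ Ω G L → P G L σ τ ≡ average σ τ
          P≡average σ∈ τ∈ = Σ-cong (allFin n) λ {v} _ → glauber-term v σ∈ τ∈

          -- Distributions evolve by the transposed kernel, which by symmetry is the kernel itself,
          -- and the constant `inv N` is stationary.
          f-suc : ∀ s {τ} → τ ∈ₗ Ω G L → f (suc s) τ ≡ ap average (f s) τ
          f-suc s {τ} τ∈ = begin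
            Σℚ (Ω G L) (λ ρ → dist G L σ₀ s ρ * P G L ρ τ) - inv N
              ≡⟨ cong (_- inv N) (Σ-cong (Ω G L) λ {ρ} ρ∈ → trans
                   (cong (dist G L σ₀ s ρ *_) (trans (P≡average ρ∈ τ∈) (average-sym ρ τ)))
                   (solve 3 (λ d a m → d :* a := a :* (d :- m) :+ a :* m) refl (dist G L σ₀ s ρ) (average τ ρ) (inv N))) ⟩
            Σℚ (Ω G L) (λ ρ → average τ ρ * f s ρ + average τ ρ * inv N) - inv N
              ≡⟨ cong (_- inv N) (Σ-+ (Ω G L) (λ ρ → average τ ρ * f s ρ) (λ ρ → average τ ρ * inv N)) ⟩
            (ap average (f s) τ + Σℚ (Ω G L) (λ ρ → average τ ρ * inv N)) - inv N
              ≡⟨ cong (λ z → (ap average (f s) τ + z) - inv N)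
                   (trans (Σ-*ʳ (Ω G L) (inv N) (average τ)) (cong (_* inv N) (average-rows τ∈))) ⟩
            (ap average (f s) τ + 1ℚ * inv N) - inv N
              ≡⟨ solve 2 (λ x m → (x :+ con 1ℚ :* m) :- m := x) refl (ap average (f s) τ) (inv N) ⟩
            ap average (f s) τ ∎
            where open ≡-Reasoning

          δ : Colouring n → ℚ
          δ = dist G L σ₀ 0

          Σδ≡1 : Σℚ (Ω G L) δ ≡ 1ℚ
          Σδ≡1 = trans (Σ-cong (Ω G L) λ {τ} _ → cong (if_then 1ℚ else 0ℚ) (isYes≗does (≡-dec ℕ._≟_ σ₀ τ)))
            (trans (Σ-if (≡-dec ℕ._≟_ σ₀) (Ω G L) 1ℚ) (cong (λ z → ι z * 1ℚ) one))
            where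
            one : length (filter (≡-dec ℕ._≟_ σ₀) (Ω G L)) ≡ 1
            one = ℕₚ.≤-antisym
              (unique⊆⇒length≤ {ys = σ₀ ∷ []} (Uniq.filter⁺ (≡-dec ℕ._≟_ σ₀) Ω-unique)
                λ x∈ → here (≡-sym (proj₂ (∈-filter⁻ (≡-dec ℕ._≟_ σ₀) {xs = Ω G L} x∈))))
              (unique⊆⇒length≤ {xs = σ₀ ∷ []} (All.[] ∷ []) λ { (here refl) → ∈-filter⁺ (≡-dec ℕ._≟_ σ₀) σ₀∈ refl })

          sq-δ : ∀ τ → δ τ * δ τ ≡ δ τ
          sq-δ τ with σ₀ ==ᶜ τ
          ... | true  = refl
          ... | false = refl

          Σf≡0 : ∀ s → Σℚ (Ω G L) (f s) ≡ 0ℚ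
          Σf≡0 zero = trans (Σ-+ (Ω G L) δ (λ _ → - inv N)) (trans (cong₂ _+_ Σδ≡1 neg) (+-inverseʳ 1ℚ))
            where
            neg : Σℚ (Ω G L) (λ _ → - inv N) ≡ - 1ℚ
            neg = trans (Σ-const (Ω G L) (- inv N)) (trans (≡-sym (neg-distribʳ-* (ι N) (inv N)))
              (cong -_ (trans (*-comm (ι N) (inv N)) (inv-ι N))))
          Σf≡0 (suc s) = begin
            Σℚ (Ω G L) (f (suc s))
              ≡⟨ Σ-cong (Ω G L) (λ τ∈ → f-suc s τ∈) ⟩
            Σℚ (Ω G L) (λ τ → Σℚ (Ω G L) λ ρ → average τ ρ * f s ρ)
              ≡⟨ Σ-swap (Ω G L) (Ω G L) (λ τ ρ → average τ ρ * f s ρ) ⟩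
            Σℚ (Ω G L) (λ ρ → Σℚ (Ω G L) λ τ → average τ ρ * f s ρ)
              ≡⟨ Σ-cong (Ω G L) (λ {ρ} ρ∈ → trans (Σ-*ʳ (Ω G L) (f s ρ) (λ τ → average τ ρ))
                   (trans (cong (_* f s ρ) (trans (Σ-cong (Ω G L) λ {τ} _ → average-sym τ ρ) (average-rows ρ∈))) (*-identityˡ (f s ρ)))) ⟩
            Σℚ (Ω G L) (f s)
              ≡⟨ Σf≡0 s ⟩
            0ℚ ∎
            where open ≡-Reasoning

          -- The exact value is 1 - `inv N`, because `δ` is an indicator.
          norm²-f0≤1 : norm² (f 0) ≤ 1ℚ
          norm²-f0≤1 = ≤-by (0≤inv N) (begin
            norm² (f 0) + ν
              ≡⟨ cong (_+ ν) (Σ-cong (Ω G L) λ {τ} _ → trans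
                   (solve 2 (λ d ν → (d :- ν) :* (d :- ν) := d :* d :+ (d :* (:- (con 2ℚ :* ν)) :+ ν :* ν)) refl (δ τ) ν)
                   (cong (_+ (δ τ * (- (2ℚ * ν)) + ν * ν)) (sq-δ τ))) ⟩
            Σℚ (Ω G L) (λ τ → δ τ + (δ τ * (- (2ℚ * ν)) + ν * ν)) + ν
              ≡⟨ cong (_+ ν) (trans (Σ-+ (Ω G L) δ (λ τ → δ τ * (- (2ℚ * ν)) + ν * ν))
                   (cong (Σℚ (Ω G L) δ +_) (Σ-+ (Ω G L) (λ τ → δ τ * (- (2ℚ * ν))) (λ _ → ν * ν)))) ⟩
            (Σℚ (Ω G L) δ + (Σℚ (Ω G L) (λ τ → δ τ * (- (2ℚ * ν))) + Σℚ (Ω G L) (λ _ → ν * ν))) + ν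
              ≡⟨ cong (_+ ν) (cong₂ _+_ Σδ≡1 (cong₂ _+_
                   (trans (Σ-*ʳ (Ω G L) (- (2ℚ * ν)) δ) (cong (_* (- (2ℚ * ν))) Σδ≡1))
                   (trans (Σ-*ʳ (Ω G L) ν (λ _ → ν)) (cong (_* ν) Σ-inv-N)))) ⟩
            (1ℚ + (1ℚ * (- (2ℚ * ν)) + 1ℚ * ν)) + ν
              ≡⟨ solve 1 (λ ν → (con 1ℚ :+ (con 1ℚ :* (:- (con 2ℚ :* ν)) :+ con 1ℚ :* ν)) :+ ν := con 1ℚ) refl ν ⟩
            1ℚ ∎)
            where
            open ≡-Reasoning
            ν : ℚ
            ν = inv N

          ker-⊤ : ∀ σ τ → ker Sub.⊤ σ τ ≡ inv N
          ker-⊤ σ τ = trans (kernel-yes Sub.⊤ (everywhere σ τ))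
            (cong (inv ∘ length) (filter-all (agree? Sub.⊤ σ) (All.universal (everywhere σ) (Ω G L))))
            where
            everywhere : ∀ σ τ → Agree Sub.⊤ σ τ
            everywhere σ τ = agree λ u u∉ → ⊥-elim (u∉ ∈⊤)

          -- Resampling everything replaces a function by its mean, which is zero for `f s`. The
          -- bound on the energy for the full set thus becomes a spectral gap.
          energy-⊤ : ∀ s → energy (ker Sub.⊤) (f s) ≡ 2ℚ * norm² (f s)
          energy-⊤ s = trans (≡-sym (trans (cong (λ z → energy (ker Sub.⊤) (f s) + 2ℚ * z) dot≡0)
              (trans (cong (energy (ker Sub.⊤) (f s) +_) (*-zeroʳ 2ℚ)) (+-identityʳ (energy (ker Sub.⊤) (f s))))))
            (energy-dot (ker-doubly Sub.⊤) (f s))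
            where
            ap≡0 : ∀ σ → ap (ker Sub.⊤) (f s) σ ≡ 0ℚ
            ap≡0 σ = trans (Σ-cong (Ω G L) λ {τ} _ → cong (_* f s τ) (ker-⊤ σ τ))
              (trans (Σ-*ˡ (Ω G L) (inv N) (f s)) (trans (cong (inv N *_) (Σf≡0 s)) (*-zeroʳ (inv N))))
            dot≡0 : dot (f s) (ap (ker Sub.⊤) (f s)) ≡ 0ℚ
            dot≡0 = trans (Σ-cong (Ω G L) λ {σ} _ → trans (cong (f s σ *_) (ap≡0 σ)) (*-zeroʳ (f s σ))) (Σ-zero (Ω G L))

          b : ℕ → ℚ
          b s = 2ℚ * norm² (f s)

          -- The gap bounds `b s` by `K` times the local energy, and `average-contracts` makes one
          -- step lose 1/n of that energy.
          b-drop : ∀ s → ι (n ℕ.* K) * b (suc s) + b s ≤ ι (n ℕ.* K) * b s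
          b-drop s = begin
            ι (n ℕ.* K) * b (suc s) + b s
              ≤⟨ +-monoʳ-≤ (ι (n ℕ.* K) * b (suc s)) (≤-trans (≤-reflexive (≡-sym (energy-⊤ s))) (bound gap (f s))) ⟩
            ι (n ℕ.* K) * b (suc s) + ι K * D
              ≡⟨ cong (ι (n ℕ.* K) * b (suc s) +_) (begin-equality
                   ι K * D                        ≡⟨ cong (_* D) (≡-sym (*-identityˡ (ι K))) ⟩
                   1ℚ * ι K * D                   ≡⟨ cong (λ z → z * ι K * D) (≡-sym (inv-ι n)) ⟩
                   inv n * ι n * ι K * D          ≡⟨ solve 4 (λ i n k d → i :* n :* k :* d := n :* k :* (i :* d)) refl (inv n) (ι n) (ι K) D ⟩
                   ι n * ι K * (inv n * D)        ≡⟨ cong (_* (inv n * D)) (≡-sym (ι-* n K)) ⟩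
                   ι (n ℕ.* K) * (inv n * D)      ∎) ⟩
            ι (n ℕ.* K) * b (suc s) + ι (n ℕ.* K) * (inv n * D)
              ≡⟨ ≡-sym (*-distribˡ-+ (ι (n ℕ.* K)) (b (suc s)) (inv n * D)) ⟩
            ι (n ℕ.* K) * (b (suc s) + inv n * D)
              ≡⟨ cong (λ z → ι (n ℕ.* K) * (2ℚ * z + inv n * D)) (Σ-cong (Ω G L) λ τ∈ → cong sq (f-suc s τ∈)) ⟩
            ι (n ℕ.* K) * (2ℚ * norm² (ap average (f s)) + inv n * D)
              ≤⟨ *-monoˡ (0≤ι (n ℕ.* K)) (average-contracts (f s)) ⟩
            ι (n ℕ.* K) * b s ∎
            where
            open ≤-Reasoning
            D : ℚ
            D = localEnergy (f s)

          0≤norm² : ∀ g → 0ℚ ≤ norm² g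
          0≤norm² g = Σ-nonneg (Ω G L) λ σ → 0≤sq (g σ)

          open Decay b (λ s → 0≤* 0≤2 (0≤norm² (f s))) (n ℕ.* K) b-drop using (decay)

          norm²-decay : ∀ j → ι (2 ℕ.^ j) * norm² (f (j ℕ.* (n ℕ.* K))) ≤ 1ℚ
          norm²-decay j = cancel-ι 2 (begin
            ι (2 ℕ.^ j) * a * ι 2     ≡⟨ solve 2 (λ x a → x :* a :* con (ι 2) := x :* (con 2ℚ :* a)) refl (ι (2 ℕ.^ j)) a ⟩
            ι (2 ℕ.^ j) * (2ℚ * a)    ≤⟨ decay j ⟩
            2ℚ * norm² (f 0)          ≤⟨ *-monoˡ 0≤2 norm²-f0≤1 ⟩
            2ℚ * 1ℚ                   ≡⟨⟩
            1ℚ * ι 2                  ∎)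
            where
            open ≤-Reasoning
            a : ℚ
            a = norm² (f (j ℕ.* (n ℕ.* K)))

          -- Cauchy-Schwarz against the constant 1, obtained from `sq-mean≤` with uniform weights.
          sq-ℓ¹≤ : ∀ g → sq (Σℚ (Ω G L) (λ τ → ℚ.∣ g τ ∣)) ≤ ι N * norm² g
          sq-ℓ¹≤ g = begin
            sq y
              ≡⟨ cong sq (≡-sym (trans (≡-sym (*-assoc (ι N) (inv N) y)) (trans (cong (_* y) (trans (*-comm (ι N) (inv N)) (inv-ι N))) (*-identityˡ y)))) ⟩
            sq (ι N * (inv N * y))
              ≡⟨ solve 2 (λ c z → (c :* z) :* (c :* z) := c :* (c :* (z :* z))) refl (ι N) (inv N * y) ⟩
            ι N * (ι N * sq (inv N * y))
              ≡⟨ cong (λ z → ι N * (ι N * sq z)) (≡-sym (Σ-*ˡ (Ω G L) (inv N) (λ τ → ℚ.∣ g τ ∣))) ⟩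
            ι N * (ι N * sq (Σℚ (Ω G L) (λ τ → inv N * ℚ.∣ g τ ∣)))
              ≤⟨ *-monoˡ (0≤ι N) (*-monoˡ (0≤ι N) (sq-mean≤ (Ω G L) (λ _ → inv N) (λ τ → ℚ.∣ g τ ∣) (λ _ → 0≤inv N) Σ-inv-N)) ⟩
            ι N * (ι N * Σℚ (Ω G L) (λ τ → inv N * sq ℚ.∣ g τ ∣))
              ≡⟨ cong (λ z → ι N * (ι N * z)) (trans (Σ-*ˡ (Ω G L) (inv N) (λ τ → sq ℚ.∣ g τ ∣)) (cong (inv N *_) (Σ-cong (Ω G L) λ {τ} _ → sq-∣∣ (g τ)))) ⟩
            ι N * (ι N * (inv N * norm² g))
              ≡⟨ cong (ι N *_) (trans (≡-sym (*-assoc (ι N) (inv N) (norm² g))) (trans (cong (_* norm² g) (trans (*-comm (ι N) (inv N)) (inv-ι N))) (*-identityˡ (norm² g)))) ⟩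
            ι N * norm² g ∎
            where
            open ≤-Reasoning
            y : ℚ
            y = Σℚ (Ω G L) (λ τ → ℚ.∣ g τ ∣)

        -- Cauchy-Schwarz costs `N`. The 4 comes from squaring `2ℚ * y`: the distance ½ y is at most
        -- 1/4 exactly when 2 y is at most 1.
        mixed : ∀ j → 4 ℕ.* N ℕ.≤ 2 ℕ.^ j → dTV G L σ₀ (j ℕ.* (n ℕ.* K)) ≤ (ℤ.+ 1) ℚ./ 4
        mixed j h = begin
          ½ * y                        ≡⟨ solve 1 (λ y → con ½ :* y := con ((ℤ.+ 1) ℚ./ 4) :* (con 2ℚ :* y)) refl y ⟩
          ((ℤ.+ 1) ℚ./ 4) * (2ℚ * y)   ≤⟨ *-monoˡ (nonNegative⁻¹ ((ℤ.+ 1) ℚ./ 4)) (sq≤1⇒≤1 (0≤* 0≤2 0≤y) small) ⟩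
          ((ℤ.+ 1) ℚ./ 4) * 1ℚ         ≡⟨ *-identityʳ ((ℤ.+ 1) ℚ./ 4) ⟩
          (ℤ.+ 1) ℚ./ 4                ∎
          where
          open ≤-Reasoning
          g : Colouring n → ℚ
          g = f (j ℕ.* (n ℕ.* K))
          y : ℚ
          y = Σℚ (Ω G L) (λ τ → ℚ.∣ g τ ∣)
          0≤y : 0ℚ ≤ y
          0≤y = Σ-nonneg (Ω G L) λ τ → 0≤∣p∣ (g τ)
          small : sq (2ℚ * y) ≤ 1ℚ
          small = begin
            sq (2ℚ * y)                 ≡⟨ solve 1 (λ y → (con 2ℚ :* y) :* (con 2ℚ :* y) := con (ι 4) :* (y :* y)) refl y ⟩
            ι 4 * sq y                  ≤⟨ *-monoˡ (0≤ι 4) (sq-ℓ¹≤ g) ⟩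
            ι 4 * (ι N * norm² g)       ≡⟨ ≡-sym (*-assoc (ι 4) (ι N) (norm² g)) ⟩
            ι 4 * ι N * norm² g         ≡⟨ cong (_* norm² g) (≡-sym (ι-* 4 N)) ⟩
            ι (4 ℕ.* N) * norm² g       ≤⟨ *-monoʳ (0≤norm² g) (ι-mono h) ⟩
            ι (2 ℕ.^ j) * norm² g       ≤⟨ norm²-decay j ⟩
            1ℚ                          ∎

open GlauberMixing

open import Data.Nat using (_≤_; _<_; _*_; _+_; _^_; _∸_; NonZero; ⌈_/2⌉; ⌊_/2⌋)

-- Arithmetic of the exponents

n≤2^⌈log₂n⌉ : ∀ n → n ≤ 2 ^ ⌈log₂ n ⌉
n≤2^⌈log₂n⌉ = <-rec (λ n → n ≤ 2 ^ ⌈log₂ n ⌉) go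
  where
  go : ∀ n → (∀ {m} → m < n → m ≤ 2 ^ ⌈log₂ m ⌉) → n ≤ 2 ^ ⌈log₂ n ⌉
  go zero          _   = z≤n
  go (suc zero)    _   = ℕₚ.≤-refl
  go (suc (suc n)) rec = begin
    N                          ≡⟨ ≡-sym (ℕₚ.⌊n/2⌋+⌈n/2⌉≡n N) ⟩
    ⌊ N /2⌋ + ⌈ N /2⌉          ≤⟨ ℕₚ.+-monoˡ-≤ ⌈ N /2⌉ (ℕₚ.⌊n/2⌋≤⌈n/2⌉ N) ⟩
    ⌈ N /2⌉ + ⌈ N /2⌉          ≡⟨ cong (⌈ N /2⌉ +_) (≡-sym (ℕₚ.+-identityʳ ⌈ N /2⌉)) ⟩
    2 * ⌈ N /2⌉                ≤⟨ ℕₚ.*-monoʳ-≤ 2 (rec (ℕₚ.⌈n/2⌉<n n)) ⟩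
    2 * 2 ^ ⌈log₂ ⌈ N /2⌉ ⌉    ≡⟨ cong (λ z → 2 * 2 ^ z) (⌈log₂⌈n/2⌉⌉≡⌈log₂n⌉∸1 N) ⟩
    2 ^ suc (⌈log₂ N ⌉ ∸ 1)    ≡⟨ cong (2 ^_) (ℕₚ.m+[n∸m]≡n (⌈log₂⌉-mono-≤ {2} {N} (s≤s (s≤s z≤n)))) ⟩
    2 ^ ⌈log₂ N ⌉              ∎
    where
    open ℕₚ.≤-Reasoning
    N : ℕ
    N = suc (suc n)

-- Half the recursion depth. The strict lower bound makes the recursion terminate, the upper bound
-- turns powers of 2^k into powers of `n`.
∃2^k∈[n,2n] : ∀ n → 1 ≤ n → ∃[ k ] (n < 2 ^ k × 2 ^ k ≤ 2 * n)
∃2^k∈[n,2n] (suc zero)    _ = 1 , s≤s (s≤s z≤n) , ℕₚ.≤-refl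
∃2^k∈[n,2n] (suc (suc n)) _ with ∃2^k∈[n,2n] (suc n) (s≤s z≤n)
... | k , lo , hi with suc (suc n) ℕ.<? 2 ^ k
...   | yes lo′ = k , lo′ , ℕₚ.≤-trans hi (ℕₚ.*-monoʳ-≤ 2 (ℕₚ.n≤1+n (suc n)))
...   | no ¬lo′ = suc k
                , ℕₚ.≤-<-trans lo (ℕₚ.m<m+n (2 ^ k) (ℕₚ.<-≤-trans (ℕₚ.m^n>0 2 k) (ℕₚ.m≤m+n (2 ^ k) 0)))
                , ℕₚ.*-monoʳ-≤ 2 (ℕₚ.≮⇒≥ ¬lo′)

-- Two levels shrink a set by 4/9, which beats halving since 8 < 9; hence the depth `2 * k`.
n*4^k<9^k : ∀ {n} k → n < 2 ^ k → n * 2 ^ (2 * k) < 3 ^ (2 * k)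
n*4^k<9^k {n} k h = begin-strict
  n * 2 ^ (2 * k)       <⟨ ℕₚ.*-monoˡ-< (2 ^ (2 * k)) {{ℕₚ.m^n≢0 2 (2 * k)}} h ⟩
  2 ^ k * 2 ^ (2 * k)   ≡⟨ ≡-sym (ℕₚ.^-distribˡ-+-* 2 k (2 * k)) ⟩
  2 ^ (3 * k)           ≡⟨ ≡-sym (ℕₚ.^-*-assoc 2 3 k) ⟩
  8 ^ k                 ≤⟨ ℕₚ.^-monoˡ-≤ k (ℕₚ.n≤1+n 8) ⟩
  9 ^ k                 ≡⟨ ℕₚ.^-*-assoc 3 2 k ⟩
  3 ^ (2 * k)           ∎
  where open ℕₚ.≤-Reasoning

1+n≤2^n : ∀ n → suc n ≤ 2 ^ n
1+n≤2^n zero    = ℕₚ.≤-refl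
1+n≤2^n (suc n) = ℕₚ.+-mono-≤ (ℕₚ.m^n>0 2 n) (ℕₚ.≤-trans (1+n≤2^n n) (ℕₚ.m≤m+n (2 ^ n) 0))

module _ {n k : ℕ} (2≤n : 2 ≤ n) (2^k≤ : 2 ^ k ≤ 2 * n) {q l : ℕ} (q≤ : q ≤ 2 ^ l) (Δ t : ℕ) where

  open ℕₚ.≤-Reasoning

  private
    instance
      n≢0 : NonZero n
      n≢0 = ℕ.>-nonZero (ℕₚ.≤-trans (s≤s z≤n) 2≤n)

    -- Binary logarithm of the cost of one level, after rounding 10 up to 2^4.
    g : ℕ
    g = (4 + (l + Δ)) * suc t + 2

    2^k≤n² : 2 ^ k ≤ n ^ 2
    2^k≤n² = ℕₚ.≤-trans 2^k≤ (ℕₚ.*-mono-≤ 2≤n (ℕₚ.≤-reflexive (≡-sym (ℕₚ.*-identityʳ n))))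

  relaxation≤ : ((10 * (q * 2 ^ Δ)) ^ suc t * 4) ^ (2 * k) ≤ n ^ (4 * g)
  relaxation≤ = begin
    ((10 * (q * 2 ^ Δ)) ^ suc t * 4) ^ (2 * k)
      ≤⟨ ℕₚ.^-monoˡ-≤ (2 * k) (ℕₚ.*-monoˡ-≤ 4 (ℕₚ.^-monoˡ-≤ (suc t)
           (ℕₚ.*-mono-≤ {10} {16} (ℕₚ.m≤m+n 10 6) (ℕₚ.*-monoˡ-≤ (2 ^ Δ) q≤)))) ⟩
    ((2 ^ 4 * (2 ^ l * 2 ^ Δ)) ^ suc t * 2 ^ 2) ^ (2 * k)
      ≡⟨ cong (λ z → ((2 ^ 4 * z) ^ suc t * 2 ^ 2) ^ (2 * k)) (≡-sym (ℕₚ.^-distribˡ-+-* 2 l Δ)) ⟩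
    ((2 ^ 4 * 2 ^ (l + Δ)) ^ suc t * 2 ^ 2) ^ (2 * k)
      ≡⟨ cong (λ z → (z ^ suc t * 2 ^ 2) ^ (2 * k)) (≡-sym (ℕₚ.^-distribˡ-+-* 2 4 (l + Δ))) ⟩
    ((2 ^ (4 + (l + Δ))) ^ suc t * 2 ^ 2) ^ (2 * k)
      ≡⟨ cong (λ z → (z * 2 ^ 2) ^ (2 * k)) (ℕₚ.^-*-assoc 2 (4 + (l + Δ)) (suc t)) ⟩
    (2 ^ ((4 + (l + Δ)) * suc t) * 2 ^ 2) ^ (2 * k)
      ≡⟨ cong (_^ (2 * k)) (≡-sym (ℕₚ.^-distribˡ-+-* 2 ((4 + (l + Δ)) * suc t) 2)) ⟩
    (2 ^ g) ^ (2 * k)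
      ≡⟨ ℕₚ.^-*-assoc 2 g (2 * k) ⟩
    2 ^ (g * (2 * k))
      ≡⟨ cong (2 ^_) (rearrange g k) ⟩
    2 ^ (k * (2 * g))
      ≡⟨ ≡-sym (ℕₚ.^-*-assoc 2 k (2 * g)) ⟩
    (2 ^ k) ^ (2 * g)
      ≤⟨ ℕₚ.^-monoˡ-≤ (2 * g) 2^k≤n² ⟩
    (n ^ 2) ^ (2 * g)
      ≡⟨ ℕₚ.^-*-assoc n 2 (2 * g) ⟩
    n ^ (2 * (2 * g))
      ≡⟨ cong (n ^_) (≡-sym (ℕₚ.*-assoc 2 2 g)) ⟩
    n ^ (4 * g) ∎
    where
    rearrange : ∀ g k → g * (2 * k) ≡ k * (2 * g)
    rearrange = solve-∀

  -- The number of halvings, about n log q, times the relaxation time. The crude bound n^(l + 1) for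
  -- the first factor is harmless, as log q is in the final exponent anyway.
  steps≤ : (n * l + 2) * (n * ((10 * (q * 2 ^ Δ)) ^ suc t * 4) ^ (2 * k)) ≤ n ^ (suc l + suc (4 * g))
  steps≤ = begin
    (n * l + 2) * (n * ((10 * (q * 2 ^ Δ)) ^ suc t * 4) ^ (2 * k))
      ≤⟨ ℕₚ.*-mono-≤ first (ℕₚ.*-monoʳ-≤ n relaxation≤) ⟩
    n ^ suc l * n ^ suc (4 * g)
      ≡⟨ ≡-sym (ℕₚ.^-distribˡ-+-* n (suc l) (suc (4 * g))) ⟩
    n ^ (suc l + suc (4 * g)) ∎
    where
    first : n * l + 2 ≤ n ^ suc l
    first = begin
      n * l + 2   ≤⟨ ℕₚ.+-monoʳ-≤ (n * l) 2≤n ⟩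
      n * l + n   ≡⟨ ℕₚ.+-comm (n * l) n ⟩
      n + n * l   ≡⟨ ≡-sym (ℕₚ.*-suc n l) ⟩
      n * suc l   ≤⟨ ℕₚ.*-monoʳ-≤ n (ℕₚ.≤-trans (1+n≤2^n l) (ℕₚ.^-monoˡ-≤ l 2≤n)) ⟩
      n ^ suc l   ∎

-- With Δ = 3 + d and t = 1 + a the difference of the two sides is a polynomial with nonnegative
-- coefficients, displayed as the added term.
exponent≤ : ∀ l {Δ t} → 3 ≤ Δ → 1 ≤ t →
            suc l + suc (4 * ((4 + (l + Δ)) * suc t + 2)) ≤ 30 * t * (Δ + l)
exponent≤ l {suc (suc (suc d))} {suc a} (s≤s (s≤s (s≤s z≤n))) (s≤s z≤n) =
  ℕₚ.≤-trans (ℕₚ.m≤m+n _ (24 + 22 * d + 21 * l + 62 * a + 26 * (a * d) + 26 * (a * l)))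
             (ℕₚ.≤-reflexive (identity l d a))
  where
  identity : ∀ l d a →
    (1 + l + (1 + 4 * ((4 + (l + (3 + d))) * (2 + a) + 2)))
      + (24 + 22 * d + 21 * l + 62 * a + 26 * (a * d) + 26 * (a * l))
    ≡ 30 * (1 + a) * (3 + d + l)
  identity = solve-∀

deg≤n : ∀ {n} (G : Graph n) v → deg G v ≤ n
deg≤n {n} G v = ℕₚ.≤-trans (length-filter _ (allFin n)) (ℕₚ.≤-reflexive (length-tabulate {n = n} id))

theorem4p5 : ∃[ C ] (∀ (n : ℕ) (G : Graph n) (Δ t q : ℕ) (L : Fin n → List ℕ) →
    MaxDegree G Δ → 3 ≤ Δ → Treewidth G t → 1 ≤ t → 1 ≤ q →
    (∀ v → Unique (L v)) →
    (∀ v → deg G v + 2 ≤ length (L v) × length (L v) ≤ q) →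
    MixingTimeAtMost G L (n ^ (C * t * (Δ + ⌈log₂ q ⌉))))
theorem4p5 = 30 , proof
  where
  proof : ∀ (n : ℕ) (G : Graph n) (Δ t q : ℕ) (L : Fin n → List ℕ) →
    MaxDegree G Δ → 3 ≤ Δ → Treewidth G t → 1 ≤ t → 1 ≤ q →
    (∀ v → Unique (L v)) →
    (∀ v → deg G v + 2 ≤ length (L v) × length (L v) ≤ q) →
    MixingTimeAtMost G L (n ^ (30 * t * (Δ + ⌈log₂ q ⌉)))
  proof n G Δ t q L (deg≤Δ , v₀ , deg≡Δ) 3≤Δ ((D , width) , _) 1≤t 1≤q L-unique sizes
    -- A vertex attains the maximum degree, so `n` is at least 3 and powers of `n` can absorb powers
    -- of 2.
    with 3≤n ← ℕₚ.≤-trans 3≤Δ (subst (_≤ n) deg≡Δ (deg≤n G v₀))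
    with k , n<2^k , 2^k≤2n ← ∃2^k∈[n,2n] n (ℕₚ.≤-trans (s≤s z≤n) 3≤n) =
    j * (n * K)
    , ℕₚ.≤-trans (steps≤ {k = k} 2≤n 2^k≤2n (n≤2^⌈log₂n⌉ q) Δ t)
        (ℕₚ.^-monoʳ-≤ n (exponent≤ ⌈log₂ q ⌉ 3≤Δ 1≤t))
    , λ σ₀ isColouring → mixed (poincare 1≤q (Balance.balanced D width) (2 * k) Sub.⊤ size)
                           (∈Ω⁺ isColouring) j 4∣Ω∣≤2^j
    where
    2≤n : 2 ≤ n
    2≤n = ℕₚ.≤-trans (ℕₚ.n≤1+n 2) 3≤n
    K j : ℕ
    K = ((10 * (q * 2 ^ Δ)) ^ suc t * 4) ^ (2 * k)
    j = n * ⌈log₂ q ⌉ + 2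
    instance
      n≢0 : NonZero n
      n≢0 = ℕ.>-nonZero (ℕₚ.≤-trans (s≤s z≤n) 2≤n)
      q≢0 : NonZero q
      q≢0 = ℕ.>-nonZero 1≤q
      K≢0 : NonZero K
      K≢0 = ℕₚ.m^n≢0 _ (2 * k) {{ℕₚ.m*n≢0 _ 4 {{ℕₚ.m^n≢0 _ (suc t)
              {{ℕₚ.m*n≢0 10 (q * 2 ^ Δ) {{_}} {{ℕₚ.m*n≢0 q (2 ^ Δ) {{q≢0}} {{ℕₚ.m^n≢0 2 Δ}}}}}}}}}}
    open Glauber G L L-unique Δ q deg≤Δ (proj₁ ∘ sizes) (proj₂ ∘ sizes)
    open Mixing
    size : ∣ Sub.⊤ {n} ∣ * 2 ^ (2 * k) < 3 ^ (2 * k)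
    size = subst (λ z → z * 2 ^ (2 * k) < 3 ^ (2 * k)) (≡-sym (∣⊤∣≡n n)) (n*4^k<9^k k n<2^k)
    4∣Ω∣≤2^j : 4 * length (Ω G L) ≤ 2 ^ j
    4∣Ω∣≤2^j = begin
      4 * length (Ω G L)            ≤⟨ ℕₚ.*-monoʳ-≤ 4 (length-filter _ (assignments L)) ⟩
      4 * length (assignments L)    ≤⟨ ℕₚ.*-monoʳ-≤ 4 (length-assignments≤ L (proj₂ ∘ sizes)) ⟩
      4 * q ^ n                     ≤⟨ ℕₚ.*-monoʳ-≤ 4 (ℕₚ.^-monoˡ-≤ n (n≤2^⌈log₂n⌉ q)) ⟩
      4 * (2 ^ ⌈log₂ q ⌉) ^ n       ≡⟨ cong (4 *_) (ℕₚ.^-*-assoc 2 ⌈log₂ q ⌉ n) ⟩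
      2 ^ 2 * 2 ^ (⌈log₂ q ⌉ * n)   ≡⟨ ≡-sym (ℕₚ.^-distribˡ-+-* 2 2 (⌈log₂ q ⌉ * n)) ⟩
      2 ^ (2 + ⌈log₂ q ⌉ * n)       ≡⟨ cong (2 ^_) (trans (ℕₚ.+-comm 2 _) (cong (_+ 2) (ℕₚ.*-comm ⌈log₂ q ⌉ n))) ⟩
      2 ^ j                         ∎
      where open ℕₚ.≤-Reasoning
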